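{- Using the definition that accumulates $\mathcal{D}(nat)$, $\mathcal{D}_{list}(atm)$, $\mathcal{D}(intuit)$, $\mathcal{D}(lambda)$ and the clause $X\equiv X\triangleq\top$ (for $\equiv\,: i\to i\to o$), the following formulas are derivable in $FO\lambda^{\Delta\mathbb{N}}$ ($\supset$ associating to the right): Determinacy: $\forall m\forall m_1\forall m_2(\vdash\langle m\Downarrow m_1\rangle\supset\ \vdash\langle m\Downarrow m_2\rangle\supset m_1\equiv m_2)$; $\forall m\forall m_1\forall m_2(\vdash\langle m\leadsto m_1\rangle\supset\ \vdash\langle m\leadsto m_2\rangle\supset m_1\equiv m_2)$; $\forall m\forall r_1\forall r_2(\vdash\langle m\leadsto^*(abs\,r_1)\rangle\supset\ \vdash\langle m\leadsto^*(abs\,r_2)\rangle\supset(abs\,r_1)\equiv(abs\,r_2))$. Equivalence: $\forall m\forall r(\vdash\langle m\Downarrow(abs\,r)\rangle\supset\ \vdash\langle m\leadsto^*(abs\,r)\rangle)$; $\forall m\forall r(\vdash\langle m\leadsto^*(abs\,r)\rangle\supset\ \vdash\langle m\Downarrow(abs\,r)\rangle)$. Subject reduction: for each $R\in\{\Downarrow,\leadsto,\leadsto^*\}$, $\forall m\forall n(\vdash\langle m\,R\,n\rangle\supset\forall t(\vdash\langle typeof\,m\,t\rangle\supset\ \vdash\langle typeof\,n\,t\rangle))$.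
   Context: $FO\lambda^{\Delta\mathbb{N}}$ is the following intuitionistic sequent calculus. Terms are simply typed $\lambda$-terms (up to $\alpha\beta\eta$-conversion) over a signature of typed constants; $o$ is the type of formulas, and quantifiers range only over types not containing $o$. Formulas are built from atomic formulas with $\bot,\top,\land,\lor,\supset,\forall,\exists$. There is a type $nt$ with constants $z:nt$, $s:nt\to nt$ and a predicate $nat: nt\to o$. Sequents are $\Gamma\longrightarrow B$, $\Gamma$ a finite multiset. Rules: $\bot,\Gamma\longrightarrow B$ and $\Gamma\longrightarrow\top$ are axioms; the usual intuitionistic left and right rules for $\land,\lor,\supset,\forall,\exists$ (with the usual eigenvariable conditions); initial sequents $A,\Gamma\longrightarrow A$ for atomic $A$; left contraction; cut. For $nat$: $\Gamma\longrightarrow nat\,z$; from $\Gamma\longrightarrow nat\,I$ infer $\Gamma\longrightarrow nat\,(s\,I)$; induction: for $B:nt\to o$ and eigenvariable $j$ not free in $B$, from $\longrightarrow B\,z$, $B\,j\longrightarrow B\,(s\,j)$, $B\,I,\Gamma\longrightarrow C$ infer $nat\,I,\Gamma\longrightarrow C$. Relative to a definition (set of clauses $\forall\bar x[p\,\bar t\triangleq B]$, free variables of $B$ occurring in $\bar t$, satisfying a level condition): right rule: from $\Gamma\longrightarrow B\theta$ infer $\Gamma\longrightarrow p\,\bar u$ when $p\,\bar u=(p\,\bar t)\theta$; left rule: infer $p\,\bar u,\Gamma\longrightarrow C$ from the premises $B\theta,\Gamma\theta\longrightarrow C\theta$ for every clause (renamed apart) and every $\theta$ in a complete set of unifiers of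 $p\,\bar u$ and $p\,\bar t$. A formula is derivable using a definition if $\longrightarrow F$ has a derivation. $\mathcal{D}(nat)$: predicates $=,<,\le: nt\to nt\to o$, $sum: nt\to nt\to nt\to o$; clauses $I=I\triangleq\top$; $sum\,z\,J\,J\triangleq nat\,J$; $sum\,(s\,I)\,J\,(s\,K)\triangleq sum\,I\,J\,K$; $z<(s\,J)\triangleq nat\,J$; $(s\,I)<(s\,J)\triangleq I<J$; $I\le I\triangleq\top$; $I\le J\triangleq I<J$. Object logic: types $i$, $atm$, $prp$, constants $\langle\cdot\rangle: atm\to prp$, $tt: prp$, $\&: prp\to prp\to prp$, $\Rightarrow: atm\to prp\to prp$, $\bigwedge: (i\to prp)\to prp$. $atmlst$ is the list type over $atm$ with $nil$ and infix $::$. $\mathcal{D}_{list}(atm)$ has clauses $length\,nil\,z\triangleq\top$; $length\,(X::L)\,(s\,I)\triangleq length\,L\,I$; $list\,L\triangleq\exists i(nat\,i\land length\,L\,i)$; $element\,X\,(X::L)\triangleq\top$; $element\,X\,(Y::L)\triangleq element\,X\,L$; $split\,nil\,nil\,nil\triangleq\top$; $split\,(X::L_1)\,(X::L_2)\,L_3\triangleq split\,L_1\,L_2\,L_3$; $split\,(X::L_1)\,L_2\,(X::L_3)\triangleq split\,L_1\,L_2\,L_3$; $permute\,nil\,nil\triangleq\top$; $permute\,(X::L_1)\,L_2\triangleq\exists l_{22}(split\,L_2\,(X::nil)\,l_{22}\land permute\,L_1\,l_{22})$. With $prog: atm\to prp\to o$ and $seq: nt\to atmlst\to prp\to o$ (first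 argument as subscript), $\mathcal{D}(intuit)$ is: $seq_I\,(A'::L)\,\langle A\rangle\triangleq element\,A\,(A'::L)$; $seq_I\,L\,tt\triangleq\top$; $seq_{(s I)}\,L\,(B\,\&\,C)\triangleq seq_I\,L\,B\land seq_I\,L\,C$; $seq_{(s I)}\,L\,(A\Rightarrow B)\triangleq seq_I\,(A::L)\,B$; $seq_{(s I)}\,L\,(\bigwedge B)\triangleq\forall x\,seq_I\,L\,(B\,x)$; $seq_{(s I)}\,L\,\langle A\rangle\triangleq\exists b(prog\,A\,b\land seq_I\,L\,b)$. $\vdash B$ abbreviates $\exists i(nat\,i\land seq_i\,nil\,B)$. Untyped $\lambda$-calculus: constants $abs:(i\to i)\to i$, $app: i\to i\to i$, $gnd: i$, $arr: i\to i\to i$, object predicates $typeof: i\to i\to atm$ and infix $\Downarrow,\leadsto,\leadsto^*: i\to i\to atm$. $\mathcal{D}(lambda)$ consists of the clauses $prog\,A\,G\triangleq\top$ for the following pairs $(A,G)$: $(typeof\,(abs\,R)\,(arr\,T\,U),\ \bigwedge n(typeof\,n\,T\Rightarrow\langle typeof\,(R\,n)\,U\rangle))$; $(typeof\,(app\,M\,N)\,T,\ \langle typeof\,M\,(arr\,U\,T)\rangle\,\&\,\langle typeof\,N\,U\rangle)$; $((abs\,R)\Downarrow(abs\,R),\ tt)$; $((app\,M\,N)\Downarrow V,\ \langle M\Downarrow(abs\,R)\rangle\,\&\,\langle(R\,N)\Downarrow V\rangle)$; $((app\,(abs\,R)\,M)\leadsto(R\,M),\ tt)$; $((app\,M\,N)\leadsto(app\,M'\,N),\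 \langle M\leadsto M'\rangle)$; $(M\leadsto^* M,\ tt)$; $(M\leadsto^* N,\ \langle M\leadsto M'\rangle\,\&\,\langle M'\leadsto^* N\rangle)$ (all variables universally quantified). -}

module Defs where

open import Data.List using (List; []; _∷_; _++_; map)
open import Data.List.Relation.Unary.All using (All)
open import Data.List.Relation.Binary.Permutation.Propositional using (_↭_)
open import Data.Unit using (⊤; tt)
open import Data.Empty using (⊥)
open import Data.Product using (_×_; _,_)

data Base : Set where
  i atm prp nt atmlst o : Base

infixr 5 _⇒_
data Ty : Set where
  ι   : Base → Ty
  _⇒_ : Ty → Ty → Ty

-- types not containing o (the only types quantifiers may range over)
NoO : Ty → Set
NoO (ι i)      = ⊤
NoO (ι atm)    = ⊤
NoO (ι prp)    = ⊤
NoO (ι nt)     = ⊤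
NoO (ι atmlst) = ⊤
NoO (ι o)      = ⊥
NoO (A ⇒ B)    = NoO A × NoO B

I N L ATM PRP O : Ty
I = ι i
N = ι nt
L = ι atmlst
ATM = ι atm
PRP = ι prp
O = ι o

Ctx : Set
Ctx = List Ty

variable
  A B C : Ty
  Γ Δ Σ Σ' : Ctx

infix 4 _∋_
data _∋_ : Ctx → Ty → Set where
  here  : (A ∷ Γ) ∋ A
  there : Γ ∋ A → (B ∷ Γ) ∋ A

data Const : Ty → Set where
  z        : Const N
  s        : Const (N ⇒ N)
  nat      : Const (N ⇒ O)
  eqN ltN leN : Const (N ⇒ N ⇒ O)
  sumN     : Const (N ⇒ N ⇒ N ⇒ O)
  nil      : Const L
  cons     : Const (ATM ⇒ L ⇒ L)
  length   : Const (L ⇒ N ⇒ O)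
  list     : Const (L ⇒ O)
  element  : Const (ATM ⇒ L ⇒ O)
  split    : Const (L ⇒ L ⇒ L ⇒ O)
  permute  : Const (L ⇒ L ⇒ O)
  ang      : Const (ATM ⇒ PRP)
  ttP      : Const PRP
  andP     : Const (PRP ⇒ PRP ⇒ PRP)
  impP     : Const (ATM ⇒ PRP ⇒ PRP)
  allP     : Const ((I ⇒ PRP) ⇒ PRP)
  prog     : Const (ATM ⇒ PRP ⇒ O)
  seq      : Const (N ⇒ L ⇒ PRP ⇒ O)
  absC     : Const ((I ⇒ I) ⇒ I)
  appC     : Const (I ⇒ I ⇒ I)
  gnd      : Const I
  arr      : Const (I ⇒ I ⇒ I)
  typeof   : Const (I ⇒ I ⇒ ATM)
  evalC    : Const (I ⇒ I ⇒ ATM)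
  stepC    : Const (I ⇒ I ⇒ ATM)
  stepsC   : Const (I ⇒ I ⇒ ATM)
  eqv      : Const (I ⇒ I ⇒ O)

-- predicates defined by the definition (nat is NOT a defined predicate)
data Defined : Const A → Set where
  d-eqN : Defined eqN
  d-ltN : Defined ltN
  d-leN : Defined leN
  d-sumN : Defined sumN
  d-length : Defined length
  d-list : Defined list
  d-element : Defined element
  d-split : Defined split
  d-permute : Defined permute
  d-prog : Defined prog
  d-seq : Defined seq
  d-eqv : Defined eqv

infixl 9 _·_
data Tm (Γ : Ctx) : Ty → Set where
  var : Γ ∋ A → Tm Γ A
  con : Const A → Tm Γ A
  lam : Tm (A ∷ Γ) B → Tm Γ (A ⇒ B)
  _·_ : Tm Γ (A ⇒ B) → Tm Γ A → Tm Γ B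

Ren : Ctx → Ctx → Set
Ren Γ Δ = ∀ {A} → Γ ∋ A → Δ ∋ A

Sub : Ctx → Ctx → Set
Sub Γ Δ = ∀ {A} → Γ ∋ A → Tm Δ A

ext : Ren Γ Δ → Ren (A ∷ Γ) (A ∷ Δ)
ext ρ here      = here
ext ρ (there x) = there (ρ x)

ren : Ren Γ Δ → Tm Γ A → Tm Δ A
ren ρ (var x) = var (ρ x)
ren ρ (con c) = con c
ren ρ (lam t) = lam (ren (ext ρ) t)
ren ρ (t · u) = ren ρ t · ren ρ u

exts : Sub Γ Δ → Sub (A ∷ Γ) (A ∷ Δ)
exts σ here      = var here
exts σ (there x) = ren there (σ x)

sub : Sub Γ Δ → Tm Γ A → Tm Δ A
sub σ (var x) = σ x
sub σ (con c) = con c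
sub σ (lam t) = lam (sub (exts σ) t)
sub σ (t · u) = sub σ t · sub σ u

sub0 : Tm Γ A → Sub (A ∷ Γ) Γ
sub0 t here      = t
sub0 t (there x) = var x

-- αβη-convertibility (α is built into de Bruijn syntax)
infix 4 _≈_
data _≈_ {Γ : Ctx} : {A : Ty} → Tm Γ A → Tm Γ A → Set where
  ≈refl  : {t : Tm Γ A} → t ≈ t
  ≈sym   : {t u : Tm Γ A} → t ≈ u → u ≈ t
  ≈trans : {t u v : Tm Γ A} → t ≈ u → u ≈ v → t ≈ v
  ≈lam   : {t u : Tm (A ∷ Γ) B} → t ≈ u → lam t ≈ lam u
  ≈app   : {t t' : Tm Γ (A ⇒ B)} {u u' : Tm Γ A} → t ≈ t' → u ≈ u' → t · u ≈ t' · u'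
  β      : {t : Tm (A ∷ Γ) B} {u : Tm Γ A} → lam t · u ≈ sub (sub0 u) t
  η      : {t : Tm Γ (A ⇒ B)} → t ≈ lam (ren there t · var here)

data DefAtom {Γ : Ctx} : {A : Ty} → Tm Γ A → Set where
  hd : {c : Const A} → Defined c → DefAtom (con c)
  ap : {t : Tm Γ (A ⇒ B)} {u : Tm Γ A} → DefAtom t → DefAtom (t · u)

infixr 6 _∧F_
infixr 5 _∨F_
infixr 4 _⊃F_
data Form (Γ : Ctx) : Set where
  atom  : Tm Γ O → Form Γ
  ⊥F ⊤F : Form Γ
  _∧F_ _∨F_ _⊃F_ : Form Γ → Form Γ → Form Γ
  ∀F ∃F : (A : Ty) → NoO A → Form (A ∷ Γ) → Form Γ

subF : Sub Γ Δ → Form Γ → Form Δ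
subF σ (atom t)   = atom (sub σ t)
subF σ ⊥F         = ⊥F
subF σ ⊤F         = ⊤F
subF σ (B ∧F C)   = subF σ B ∧F subF σ C
subF σ (B ∨F C)   = subF σ B ∨F subF σ C
subF σ (B ⊃F C)   = subF σ B ⊃F subF σ C
subF σ (∀F A p B) = ∀F A p (subF (exts σ) B)
subF σ (∃F A p B) = ∃F A p (subF (exts σ) B)

wkF : Form Γ → Form (A ∷ Γ)
wkF = subF (λ x → var (there x))

_[_]F : Form (A ∷ Γ) → Tm Γ A → Form Γ
B [ t ]F = subF (sub0 t) B

succSub : Sub (N ∷ Γ) (N ∷ Γ)
succSub here      = con s · var here
succSub (there x) = var (there x)

infix 4 _≈F_
data _≈F_ {Γ : Ctx} : Form Γ → Form Γ → Set where
  atom≈ : {t u : Tm Γ O} → t ≈ u → atom t ≈F atom u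
  ⊥≈    : ⊥F ≈F ⊥F
  ⊤≈    : ⊤F ≈F ⊤F
  ∧≈    : {B B' C C' : Form Γ} → B ≈F B' → C ≈F C' → (B ∧F C) ≈F (B' ∧F C')
  ∨≈    : {B B' C C' : Form Γ} → B ≈F B' → C ≈F C' → (B ∨F C) ≈F (B' ∨F C')
  ⊃≈    : {B B' C C' : Form Γ} → B ≈F B' → C ≈F C' → (B ⊃F C) ≈F (B' ⊃F C')
  ∀≈    : {p : NoO A} {B B' : Form (A ∷ Γ)} → B ≈F B' → ∀F A p B ≈F ∀F A p B'
  ∃≈    : {p : NoO A} {B B' : Form (A ∷ Γ)} → B ≈F B' → ∃F A p B ≈F ∃F A p B'

v0 : Tm (A ∷ Γ) A
v0 = var here
v1 : Tm (B ∷ A ∷ Γ) A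
v1 = var (there here)
v2 : Tm (C ∷ B ∷ A ∷ Γ) A
v2 = var (there (there here))
v3 : {D : Ty} → Tm (D ∷ C ∷ B ∷ A ∷ Γ) A
v3 = var (there (there (there here)))

Z : Tm Γ N
Z = con z
S : Tm Γ N → Tm Γ N
S t = con s · t
NIL : Tm Γ L
NIL = con nil
_∷ₜ_ : Tm Γ ATM → Tm Γ L → Tm Γ L
x ∷ₜ l = con cons · x · l
⟨_⟩ : Tm Γ ATM → Tm Γ PRP
⟨ a ⟩ = con ang · a
_&_ : Tm Γ PRP → Tm Γ PRP → Tm Γ PRP
p & q = con andP · p · q

data Clause : Set where
  c-eq c-sum0 c-sumS c-lt0 c-ltS c-leRefl c-leLt : Clause
  c-len0 c-lenS c-list c-elem1 c-elem2 c-split0 c-split1 c-split2 c-perm0 c-permS : Clause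
  c-seqAtom c-seqTT c-seqAnd c-seqImp c-seqAll c-seqBack : Clause
  c-tyAbs c-tyApp c-evAbs c-evApp c-stBeta c-stApp c-stsRefl c-stsStep : Clause
  c-equiv : Clause

cctx : Clause → Ctx
cctx c-eq       = N ∷ []
cctx c-sum0     = N ∷ []
cctx c-sumS     = N ∷ N ∷ N ∷ []
cctx c-lt0      = N ∷ []
cctx c-ltS      = N ∷ N ∷ []
cctx c-leRefl   = N ∷ []
cctx c-leLt     = N ∷ N ∷ []
cctx c-len0     = []
cctx c-lenS     = ATM ∷ L ∷ N ∷ []
cctx c-list     = L ∷ []
cctx c-elem1    = ATM ∷ L ∷ []
cctx c-elem2    = ATM ∷ ATM ∷ L ∷ []
cctx c-split0   = []
cctx c-split1   = ATM ∷ L ∷ L ∷ L ∷ []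
cctx c-split2   = ATM ∷ L ∷ L ∷ L ∷ []
cctx c-perm0    = []
cctx c-permS    = ATM ∷ L ∷ L ∷ []
cctx c-seqAtom  = N ∷ ATM ∷ L ∷ ATM ∷ []
cctx c-seqTT    = N ∷ L ∷ []
cctx c-seqAnd   = N ∷ L ∷ PRP ∷ PRP ∷ []
cctx c-seqImp   = N ∷ L ∷ ATM ∷ PRP ∷ []
cctx c-seqAll   = N ∷ L ∷ (I ⇒ PRP) ∷ []
cctx c-seqBack  = N ∷ L ∷ ATM ∷ []
cctx c-tyAbs    = (I ⇒ I) ∷ I ∷ I ∷ []
cctx c-tyApp    = I ∷ I ∷ I ∷ I ∷ []
cctx c-evAbs    = (I ⇒ I) ∷ []
cctx c-evApp    = I ∷ I ∷ I ∷ (I ⇒ I) ∷ []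
cctx c-stBeta   = (I ⇒ I) ∷ I ∷ []
cctx c-stApp    = I ∷ I ∷ I ∷ []
cctx c-stsRefl  = I ∷ []
cctx c-stsStep  = I ∷ I ∷ I ∷ []
cctx c-equiv    = I ∷ []

chead : (c : Clause) → Tm (cctx c) O
chead c-eq      = con eqN · v0 · v0
chead c-sum0    = con sumN · Z · v0 · v0
chead c-sumS    = con sumN · S v0 · v1 · S v2
chead c-lt0     = con ltN · Z · S v0
chead c-ltS     = con ltN · S v0 · S v1
chead c-leRefl  = con leN · v0 · v0
chead c-leLt    = con leN · v0 · v1
chead c-len0    = con length · NIL · Z
chead c-lenS    = con length · (v0 ∷ₜ v1) · S v2
chead c-list    = con list · v0
chead c-elem1   = con element · v0 · (v0 ∷ₜ v1)
chead c-elem2   = con element · v0 · (v1 ∷ₜ v2)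
chead c-split0  = con split · NIL · NIL · NIL
chead c-split1  = con split · (v0 ∷ₜ v1) · (v0 ∷ₜ v2) · v3
chead c-split2  = con split · (v0 ∷ₜ v1) · v2 · (v0 ∷ₜ v3)
chead c-perm0   = con permute · NIL · NIL
chead c-permS   = con permute · (v0 ∷ₜ v1) · v2
chead c-seqAtom = con seq · v0 · (v1 ∷ₜ v2) · ⟨ v3 ⟩
chead c-seqTT   = con seq · v0 · v1 · con ttP
chead c-seqAnd  = con seq · S v0 · v1 · (v2 & v3)
chead c-seqImp  = con seq · S v0 · v1 · (con impP · v2 · v3)
chead c-seqAll  = con seq · S v0 · v1 · (con allP · v2)
chead c-seqBack = con seq · S v0 · v1 · ⟨ v2 ⟩
chead c-tyAbs   = con prog · (con typeof · (con absC · v0) · (con arr · v1 · v2))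
                           · (con allP · lam (con impP · (con typeof · v0 · v2)
                                                       · ⟨ con typeof · (v1 · v0) · v3 ⟩))
chead c-tyApp   = con prog · (con typeof · (con appC · v0 · v1) · v2)
                           · (⟨ con typeof · v0 · (con arr · v3 · v2) ⟩ & ⟨ con typeof · v1 · v3 ⟩)
chead c-evAbs   = con prog · (con evalC · (con absC · v0) · (con absC · v0)) · con ttP
chead c-evApp   = con prog · (con evalC · (con appC · v0 · v1) · v2)
                           · (⟨ con evalC · v0 · (con absC · v3) ⟩ & ⟨ con evalC · (v3 · v1) · v2 ⟩)
chead c-stBeta  = con prog · (con stepC · (con appC · (con absC · v0) · v1) · (v0 · v1)) · con ttP
chead c-stApp   = con prog · (con stepC · (con appC · v0 · v1) · (con appC · v2 · v1))
                           · ⟨ con stepC · v0 · v2 ⟩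
chead c-stsRefl = con prog · (con stepsC · v0 · v0) · con ttP
chead c-stsStep = con prog · (con stepsC · v0 · v1)
                           · (⟨ con stepC · v0 · v2 ⟩ & ⟨ con stepsC · v2 · v1 ⟩)
chead c-equiv   = con eqv · v0 · v0

cbody : (c : Clause) → Form (cctx c)
cbody c-eq      = ⊤F
cbody c-sum0    = atom (con nat · v0)
cbody c-sumS    = atom (con sumN · v0 · v1 · v2)
cbody c-lt0     = atom (con nat · v0)
cbody c-ltS     = atom (con ltN · v0 · v1)
cbody c-leRefl  = ⊤F
cbody c-leLt    = atom (con ltN · v0 · v1)
cbody c-len0    = ⊤F
cbody c-lenS    = atom (con length · v1 · v2)
cbody c-list    = ∃F N tt (atom (con nat · v0) ∧F atom (con length · v1 · v0))
cbody c-elem1   = ⊤F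
cbody c-elem2   = atom (con element · v0 · v2)
cbody c-split0  = ⊤F
cbody c-split1  = atom (con split · v1 · v2 · v3)
cbody c-split2  = atom (con split · v1 · v2 · v3)
cbody c-perm0   = ⊤F
cbody c-permS   = ∃F L tt (atom (con split · v3 · (v1 ∷ₜ NIL) · v0)
                           ∧F atom (con permute · v2 · v0))
cbody c-seqAtom = atom (con element · v3 · (v1 ∷ₜ v2))
cbody c-seqTT   = ⊤F
cbody c-seqAnd  = atom (con seq · v0 · v1 · v2) ∧F atom (con seq · v0 · v1 · v3)
cbody c-seqImp  = atom (con seq · v0 · (v2 ∷ₜ v1) · v3)
cbody c-seqAll  = ∀F I tt (atom (con seq · v1 · v2 · (v3 · v0)))
cbody c-seqBack = ∃F PRP tt (atom (con prog · v3 · v0) ∧F atom (con seq · v1 · v2 · v0))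
cbody c-tyAbs   = ⊤F
cbody c-tyApp   = ⊤F
cbody c-evAbs   = ⊤F
cbody c-evApp   = ⊤F
cbody c-stBeta  = ⊤F
cbody c-stApp   = ⊤F
cbody c-stsRefl = ⊤F
cbody c-stsStep = ⊤F
cbody c-equiv   = ⊤F

-- The sequent calculus FOλ^{ΔN} relative to the above definition.
-- Σ ⨾ Γ ⟶ C : Σ the eigenvariables (signature), Γ the hypotheses
-- (a multiset, represented as a list with an exchange rule).

infix 2 _⨾_⟶_
data _⨾_⟶_ : (Σ : Ctx) → List (Form Σ) → Form Σ → Set where
  ⊥L   : {Γ : List (Form Σ)} {C : Form Σ} → Σ ⨾ ⊥F ∷ Γ ⟶ C
  ⊤R   : {Γ : List (Form Σ)} → Σ ⨾ Γ ⟶ ⊤F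
  init : {Γ : List (Form Σ)} {t : Tm Σ O} → Σ ⨾ atom t ∷ Γ ⟶ atom t
  ∧L₁  : {Γ : List (Form Σ)} {B C D : Form Σ} →
         Σ ⨾ B ∷ Γ ⟶ D → Σ ⨾ (B ∧F C) ∷ Γ ⟶ D
  ∧L₂  : {Γ : List (Form Σ)} {B C D : Form Σ} →
         Σ ⨾ C ∷ Γ ⟶ D → Σ ⨾ (B ∧F C) ∷ Γ ⟶ D
  ∧R   : {Γ : List (Form Σ)} {B C : Form Σ} →
         Σ ⨾ Γ ⟶ B → Σ ⨾ Γ ⟶ C → Σ ⨾ Γ ⟶ B ∧F C
  ∨L   : {Γ : List (Form Σ)} {B C D : Form Σ} →
         Σ ⨾ B ∷ Γ ⟶ D → Σ ⨾ C ∷ Γ ⟶ D → Σ ⨾ (B ∨F C) ∷ Γ ⟶ D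
  ∨R₁  : {Γ : List (Form Σ)} {B C : Form Σ} → Σ ⨾ Γ ⟶ B → Σ ⨾ Γ ⟶ B ∨F C
  ∨R₂  : {Γ : List (Form Σ)} {B C : Form Σ} → Σ ⨾ Γ ⟶ C → Σ ⨾ Γ ⟶ B ∨F C
  ⊃L   : {Γ : List (Form Σ)} {B C D : Form Σ} →
         Σ ⨾ Γ ⟶ B → Σ ⨾ C ∷ Γ ⟶ D → Σ ⨾ (B ⊃F C) ∷ Γ ⟶ D
  ⊃R   : {Γ : List (Form Σ)} {B C : Form Σ} →
         Σ ⨾ B ∷ Γ ⟶ C → Σ ⨾ Γ ⟶ B ⊃F C
  ∀L   : {Γ : List (Form Σ)} {p : NoO A} {B : Form (A ∷ Σ)} {D : Form Σ} →
         (t : Tm Σ A) → Σ ⨾ (B [ t ]F) ∷ Γ ⟶ D → Σ ⨾ ∀F A p B ∷ Γ ⟶ D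
  ∀R   : {Γ : List (Form Σ)} {p : NoO A} {B : Form (A ∷ Σ)} →
         (A ∷ Σ) ⨾ map wkF Γ ⟶ B → Σ ⨾ Γ ⟶ ∀F A p B
  ∃L   : {Γ : List (Form Σ)} {p : NoO A} {B : Form (A ∷ Σ)} {D : Form Σ} →
         (A ∷ Σ) ⨾ B ∷ map wkF Γ ⟶ wkF D → Σ ⨾ ∃F A p B ∷ Γ ⟶ D
  ∃R   : {Γ : List (Form Σ)} {p : NoO A} {B : Form (A ∷ Σ)} →
         (t : Tm Σ A) → Σ ⨾ Γ ⟶ (B [ t ]F) → Σ ⨾ Γ ⟶ ∃F A p B
  contr : {Γ : List (Form Σ)} {B D : Form Σ} →
          Σ ⨾ B ∷ B ∷ Γ ⟶ D → Σ ⨾ B ∷ Γ ⟶ D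
  exch : {Γ Γ' : List (Form Σ)} {D : Form Σ} →
         Γ ↭ Γ' → Σ ⨾ Γ ⟶ D → Σ ⨾ Γ' ⟶ D
  cut  : {Γ₁ Γ₂ : List (Form Σ)} {B D : Form Σ} →
         Σ ⨾ Γ₁ ⟶ B → Σ ⨾ B ∷ Γ₂ ⟶ D → Σ ⨾ Γ₁ ++ Γ₂ ⟶ D
  -- formulas are taken up to αβη-conversion
  convL : {Γ : List (Form Σ)} {B B' D : Form Σ} →
          B ≈F B' → Σ ⨾ B ∷ Γ ⟶ D → Σ ⨾ B' ∷ Γ ⟶ D
  convR : {Γ : List (Form Σ)} {B B' : Form Σ} →
          B ≈F B' → Σ ⨾ Γ ⟶ B → Σ ⨾ Γ ⟶ B'
  natZ : {Γ : List (Form Σ)} → Σ ⨾ Γ ⟶ atom (con nat · Z)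
  natS : {Γ : List (Form Σ)} {t : Tm Σ N} →
         Σ ⨾ Γ ⟶ atom (con nat · t) → Σ ⨾ Γ ⟶ atom (con nat · S t)
  ind  : {Γ : List (Form Σ)} {t : Tm Σ N} {D : Form Σ} →
         (B : Form (N ∷ Σ)) →
         Σ ⨾ [] ⟶ B [ Z ]F →
         (N ∷ Σ) ⨾ B ∷ [] ⟶ subF succSub B →
         Σ ⨾ (B [ t ]F) ∷ Γ ⟶ D →
         Σ ⨾ atom (con nat · t) ∷ Γ ⟶ D
  defR : {Γ : List (Form Σ)} →
         (c : Clause) (θ : Sub (cctx c) Σ) →
         Σ ⨾ Γ ⟶ subF θ (cbody c) → Σ ⨾ Γ ⟶ atom (sub θ (chead c))
  -- one premise for every clause and every unifier (σ on the eigenvariables,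
  -- τ on the renamed-apart clause variables); the set of all unifiers is a
  -- complete set of unifiers
  defL : {Γ : List (Form Σ)} {u : Tm Σ O} {D : Form Σ} →
         DefAtom u →
         ((c : Clause) (Σ' : Ctx) → All NoO Σ' →
          (σ : Sub Σ Σ') (τ : Sub (cctx c) Σ') →
          sub σ u ≈ sub τ (chead c) →
          Σ' ⨾ subF τ (cbody c) ∷ map (subF σ) Γ ⟶ subF σ D) →
         Σ ⨾ atom u ∷ Γ ⟶ D

Derivable : Form [] → Set
Derivable F = [] ⨾ [] ⟶ F

⊢_ : Tm Γ PRP → Form Γ
⊢ b = ∃F N tt (atom (con nat · v0) ∧F atom (con seq · v0 · NIL · ren there b))

ATMREL = Const (I ⇒ I ⇒ ATM)

determinacy : ATMREL → Form []
determinacy R =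
  ∀F I tt (∀F I tt (∀F I tt
    ((⊢ ⟨ con R · v2 · v1 ⟩) ⊃F (⊢ ⟨ con R · v2 · v0 ⟩) ⊃F atom (con eqv · v1 · v0))))

determinacyStar : Form []
determinacyStar =
  ∀F I tt (∀F (I ⇒ I) (tt , tt) (∀F (I ⇒ I) (tt , tt)
    ((⊢ ⟨ con stepsC · v2 · (con absC · v1) ⟩) ⊃F
     (⊢ ⟨ con stepsC · v2 · (con absC · v0) ⟩) ⊃F
     atom (con eqv · (con absC · v1) · (con absC · v0)))))

equivalence : ATMREL → ATMREL → Form []
equivalence R₁ R₂ =
  ∀F I tt (∀F (I ⇒ I) (tt , tt)
    ((⊢ ⟨ con R₁ · v1 · (con absC · v0) ⟩) ⊃F (⊢ ⟨ con R₂ · v1 · (con absC · v0) ⟩)))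

subjectReduction : ATMREL → Form []
subjectReduction R =
  ∀F I tt (∀F I tt
    ((⊢ ⟨ con R · v1 · v0 ⟩) ⊃F
     ∀F I tt ((⊢ ⟨ con typeof · v2 · v0 ⟩) ⊃F (⊢ ⟨ con typeof · v1 · v0 ⟩))))

{-# OPTIONS --safe #-}
module Submission where

-- Object-level cut needs no induction on the cut formula: hypothesis lists contain only atoms, and
-- backchaining consults `prog` alone, so a hypothesis is used only at leaves introduced by
-- `c-seqAtom`. Cut replaces these leaves. The difficulty is the index: the replacing proof arrives
-- with its own index j and must be raised to that of the leaf, yet raising an index is itself an
-- instance of the replacement lemma. The circle is broken at j = z, where an atom is provable only
-- as a hypothesis and so at every index. Since the left rule for definitions has a premise for
-- every unifier, no most general unifier is ever computed: a unifier enters only through the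
-- convertibility it solves.

-- All theorems go by induction, inside FOλ^{ΔN}, on the index of an object-level derivation;
-- inverting a derivation lowers the index by one (backchaining) or two (backchaining and &).
-- Two facts carry the argument.  First, terms with a constant at the head are convertible only if
-- the constants agree and the arguments are convertible, so the left rule for a defined atom
-- reduces to the clauses whose head matches it.  This comes from a logical relation based on
-- weak-head reduction.  Second, the object logic admits cut, with an index that depends
-- only on the indices of the two premises; cut with A = typeof N U applied to a derivation of
-- typeof (R N) T from the hypothesis A gives preservation of types under β, and the degenerate
-- instance without cut formula brings two derivations to a common index.

open import Defs
open import Data.Empty using (⊥; ⊥-elim)
open import Data.List using (List; []; _∷_; _++_; map)
open import Data.List.Properties using (map-++; map-∘; map-cong; ++-identityʳ)
open import Data.List.Relation.Binary.Permutation.Propositional using (prep; ↭-sym; ↭-trans)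
open import Data.List.Relation.Binary.Permutation.Propositional.Properties using (shift; map⁺; ++-comm; ++⁺ˡ)
open import Data.List.Relation.Unary.All using (All; []; _∷_)
open import Data.Maybe using (Maybe; just; nothing)
open import Data.Product using (_×_; _,_; ∃-syntax; proj₁; proj₂)
open import Data.Unit using (⊤; tt)
open import Relation.Binary.PropositionalEquality using (_≡_; refl; sym; trans; cong; cong₂; subst; subst₂)

variable
  Θ Ξ : Ctx
  Π : List (Form Σ)
  Π' : List (Form Σ')

-- Renaming, substitution and convertibility of terms

ren-ren : ∀ {ρ : Ren Γ Δ} {ρ' : Ren Δ Θ} {ρ'' : Ren Γ Θ} →
          (∀ {A} (x : Γ ∋ A) → ρ' (ρ x) ≡ ρ'' x) → (t : Tm Γ A) → ren ρ' (ren ρ t) ≡ ren ρ'' t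
ren-ren h (var x) = cong var (h x)
ren-ren h (con c) = refl
ren-ren h (lam t) = cong lam (ren-ren (λ { here → refl ; (there x) → cong there (h x) }) t)
ren-ren h (t · u) = cong₂ _·_ (ren-ren h t) (ren-ren h u)

sub-ren : ∀ {ρ : Ren Γ Δ} {σ : Sub Δ Θ} {τ : Sub Γ Θ} →
          (∀ {A} (x : Γ ∋ A) → σ (ρ x) ≡ τ x) → (t : Tm Γ A) → sub σ (ren ρ t) ≡ sub τ t
sub-ren h (var x) = h x
sub-ren h (con c) = refl
sub-ren h (lam t) = cong lam (sub-ren (λ { here → refl ; (there x) → cong (ren there) (h x) }) t)
sub-ren h (t · u) = cong₂ _·_ (sub-ren h t) (sub-ren h u)

ren-sub : ∀ {σ : Sub Γ Δ} {ρ : Ren Δ Θ} {τ : Sub Γ Θ} →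
          (∀ {A} (x : Γ ∋ A) → ren ρ (σ x) ≡ τ x) → (t : Tm Γ A) → ren ρ (sub σ t) ≡ sub τ t
ren-sub h (var x) = h x
ren-sub h (con c) = refl
ren-sub {Γ = Γ} {σ = σ} {ρ} {τ} h (lam {A = A} t) = cong lam (ren-sub h' t)
  where
  h' : ∀ {B} (x : (A ∷ Γ) ∋ B) → ren (ext ρ) (exts σ x) ≡ exts τ x
  h' here      = refl
  h' (there x) = trans (trans (ren-ren (λ _ → refl) (σ x)) (sym (ren-ren (λ _ → refl) (σ x))))
                       (cong (ren there) (h x))
ren-sub h (t · u) = cong₂ _·_ (ren-sub h t) (ren-sub h u)

sub-exts-wk : (σ : Sub Γ Δ) (t : Tm Γ A) → sub (exts {A = B} σ) (ren there t) ≡ ren there (sub σ t)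
sub-exts-wk σ t = trans (sub-ren (λ _ → refl) t) (sym (ren-sub (λ _ → refl) t))

exts-∘ : ∀ {σ : Sub Γ Δ} {τ : Sub Δ Θ} {υ : Sub Γ Θ} →
         (∀ {A} (x : Γ ∋ A) → sub τ (σ x) ≡ υ x) →
         ∀ {A} (x : (B ∷ Γ) ∋ A) → sub (exts τ) (exts σ x) ≡ exts υ x
exts-∘ h here      = refl
exts-∘ {σ = σ} {τ} h (there x) = trans (sub-exts-wk τ (σ x)) (cong (ren there) (h x))

sub-sub : ∀ {σ : Sub Γ Δ} {τ : Sub Δ Θ} {υ : Sub Γ Θ} →
          (∀ {A} (x : Γ ∋ A) → sub τ (σ x) ≡ υ x) → (t : Tm Γ A) → sub τ (sub σ t) ≡ sub υ t
sub-sub h (var x) = h x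
sub-sub h (con c) = refl
sub-sub h (lam t) = cong lam (sub-sub (exts-∘ h) t)
sub-sub h (t · u) = cong₂ _·_ (sub-sub h t) (sub-sub h u)

exts-var : ∀ {σ : Sub Γ Γ} → (∀ {A} (x : Γ ∋ A) → σ x ≡ var x) →
           ∀ {A} (x : (B ∷ Γ) ∋ A) → exts σ x ≡ var x
exts-var h here      = refl
exts-var h (there x) = cong (ren there) (h x)

sub-id : ∀ {σ : Sub Γ Γ} → (∀ {A} (x : Γ ∋ A) → σ x ≡ var x) → (t : Tm Γ A) → sub σ t ≡ t
sub-id h (var x) = h x
sub-id h (con c) = refl
sub-id h (lam t) = cong lam (sub-id (exts-var h) t)
sub-id h (t · u) = cong₂ _·_ (sub-id h t) (sub-id h u)

sub-var : (t : Tm Γ A) → sub var t ≡ t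
sub-var = sub-id (λ _ → refl)

ren-as-sub : (ρ : Ren Γ Δ) (t : Tm Γ A) → ren ρ t ≡ sub (λ x → var (ρ x)) t
ren-as-sub ρ t = trans (sym (sub-var (ren ρ t))) (sub-ren (λ _ → refl) t)

ren-id : (t : Tm Γ A) → ren (λ x → x) t ≡ t
ren-id t = trans (ren-as-sub _ t) (sub-var t)

sub-sub0-wk : (u : Tm Γ B) (t : Tm Γ A) → sub (sub0 u) (ren there t) ≡ t
sub-sub0-wk u t = trans (sub-ren (λ _ → refl) t) (sub-var t)

consS : Tm Δ A → Sub Γ Δ → Sub (A ∷ Γ) Δ
consS t σ here      = t
consS t σ (there x) = σ x

sub0-exts : (σ : Sub Γ Δ) (u : Tm Δ A) (t : Tm (A ∷ Γ) B) →
            sub (sub0 u) (sub (exts σ) t) ≡ sub (consS u σ) t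
sub0-exts σ u = sub-sub (λ { here → refl ; (there x) → sub-sub0-wk u (σ x) })

sub-sub0 : (σ : Sub Γ Δ) (u : Tm Γ A) (t : Tm (A ∷ Γ) B) →
           sub σ (sub (sub0 u) t) ≡ sub (consS (sub σ u) σ) t
sub-sub0 σ u = sub-sub (λ { here → refl ; (there x) → refl })

ren-β : (ρ : Ren Γ Δ) (u : Tm Γ A) (t : Tm (A ∷ Γ) B) →
        ren ρ (sub (sub0 u) t) ≡ sub (sub0 (ren ρ u)) (ren (ext ρ) t)
ren-β ρ u t = trans (ren-sub (λ _ → refl) t)
                    (sym (sub-ren (λ { here → refl ; (there x) → refl }) t))

≡⇒≈ : {t u : Tm Γ A} → t ≡ u → t ≈ u
≡⇒≈ refl = ≈refl

sub-≈ : (σ : Sub Γ Δ) {t u : Tm Γ A} → t ≈ u → sub σ t ≈ sub σ u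
sub-≈ σ ≈refl        = ≈refl
sub-≈ σ (≈sym e)     = ≈sym (sub-≈ σ e)
sub-≈ σ (≈trans e f) = ≈trans (sub-≈ σ e) (sub-≈ σ f)
sub-≈ σ (≈lam e)     = ≈lam (sub-≈ (exts σ) e)
sub-≈ σ (≈app e f)   = ≈app (sub-≈ σ e) (sub-≈ σ f)
sub-≈ σ (β {t = t} {u}) =
  ≈trans β (≡⇒≈ (trans (sub0-exts σ (sub σ u) t) (sym (sub-sub0 σ u t))))
sub-≈ σ (η {t = t})  = ≈trans η (≈lam (≈app (≡⇒≈ (sym (sub-exts-wk σ t))) ≈refl))

ren-≈ : (ρ : Ren Γ Δ) {t u : Tm Γ A} → t ≈ u → ren ρ t ≈ ren ρ u
ren-≈ ρ {t} {u} e = subst₂ _≈_ (sym (ren-as-sub ρ t)) (sym (ren-as-sub ρ u)) (sub-≈ _ e)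

exts-≈ : {σ τ : Sub Γ Δ} → (∀ {A} (x : Γ ∋ A) → σ x ≈ τ x) →
         ∀ {A} (x : (B ∷ Γ) ∋ A) → exts σ x ≈ exts τ x
exts-≈ h here      = ≈refl
exts-≈ h (there x) = ren-≈ there (h x)

sub-cong-≈ : {σ τ : Sub Γ Δ} → (∀ {A} (x : Γ ∋ A) → σ x ≈ τ x) → (t : Tm Γ A) → sub σ t ≈ sub τ t
sub-cong-≈ h (var x) = h x
sub-cong-≈ h (con c) = ≈refl
sub-cong-≈ h (lam t) = ≈lam (sub-cong-≈ (exts-≈ h) t)
sub-cong-≈ h (t · u) = ≈app (sub-cong-≈ h t) (sub-cong-≈ h u)

-- Injectivity of rigid heads modulo βη

infix 4 _⟼_ _↠_ _~_
data _⟼_ {Γ : Ctx} : {A : Ty} → Tm Γ A → Tm Γ A → Set where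
  β⟼ : {t : Tm (A ∷ Γ) B} {u : Tm Γ A} → lam t · u ⟼ sub (sub0 u) t
  ξ⟼ : {t t' : Tm Γ (A ⇒ B)} {u : Tm Γ A} → t ⟼ t' → t · u ⟼ t' · u

data _↠_ {Γ : Ctx} {A : Ty} : Tm Γ A → Tm Γ A → Set where
  done : {t : Tm Γ A} → t ↠ t
  _◅_  : {t u v : Tm Γ A} → t ⟼ u → u ↠ v → t ↠ v

-- Arguments are compared by `≈` alone, so one layer below the head is exposed at a time; this is
-- what injectivity asks for, and full normal forms are avoided.
data _~_ {Γ : Ctx} : {A : Ty} → Tm Γ A → Tm Γ A → Set where
  ~var : {x : Γ ∋ A} → var x ~ var x
  ~con : {c : Const A} → con c ~ con c
  _~·_ : {t t' : Tm Γ (A ⇒ B)} {u u' : Tm Γ A} → t ~ t' → u ≈ u' → t · u ~ t' · u'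

infixl 9 _~·_

Neutral : Tm Γ A → Set
Neutral (var x) = ⊤
Neutral (con c) = ⊤
Neutral (lam t) = ⊥
Neutral (t · u) = Neutral t

neutral-⟼ : {t t' : Tm Γ A} → Neutral t → t ⟼ t' → ⊥
neutral-⟼ n (ξ⟼ r) = neutral-⟼ n r

neutral-↠ : {t t' : Tm Γ A} → Neutral t → t ↠ t' → t ≡ t'
neutral-↠ n done    = refl
neutral-↠ n (r ◅ _) = ⊥-elim (neutral-⟼ n r)

~neutralˡ : {t u : Tm Γ A} → t ~ u → Neutral t
~neutralˡ ~var     = tt
~neutralˡ ~con     = tt
~neutralˡ (n ~· _) = ~neutralˡ n

~sym : {t u : Tm Γ A} → t ~ u → u ~ t
~sym ~var     = ~var
~sym ~con     = ~con
~sym (n ~· e) = ~sym n ~· ≈sym e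

~trans : {t u v : Tm Γ A} → t ~ u → u ~ v → t ~ v
~trans ~var     ~var     = ~var
~trans ~con     ~con     = ~con
~trans (n ~· e) (m ~· f) = ~trans n m ~· ≈trans e f

~⇒≈ : {t u : Tm Γ A} → t ~ u → t ≈ u
~⇒≈ ~var     = ≈refl
~⇒≈ ~con     = ≈refl
~⇒≈ (n ~· e) = ≈app (~⇒≈ n) e

ren-~ : (ρ : Ren Γ Δ) {t u : Tm Γ A} → t ~ u → ren ρ t ~ ren ρ u
ren-~ ρ ~var     = ~var
ren-~ ρ ~con     = ~con
ren-~ ρ (n ~· e) = ren-~ ρ n ~· ren-≈ ρ e

⟼⇒≈ : {t u : Tm Γ A} → t ⟼ u → t ≈ u
⟼⇒≈ β⟼     = β
⟼⇒≈ (ξ⟼ r) = ≈app (⟼⇒≈ r) ≈refl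

↠⇒≈ : {t u : Tm Γ A} → t ↠ u → t ≈ u
↠⇒≈ done     = ≈refl
↠⇒≈ (r ◅ rs) = ≈trans (⟼⇒≈ r) (↠⇒≈ rs)

⟼-det : {t u v : Tm Γ A} → t ⟼ u → t ⟼ v → u ≡ v
⟼-det β⟼     β⟼     = refl
⟼-det (ξ⟼ r) (ξ⟼ q) = cong (_· _) (⟼-det r q)

↠-det : {t u v : Tm Γ A} → Neutral u → Neutral v → t ↠ u → t ↠ v → u ≡ v
↠-det n m done     rs       = neutral-↠ n rs
↠-det n m rs@(_ ◅ _) done   = sym (neutral-↠ m rs)
↠-det n m (r ◅ rs) (q ◅ qs) with refl ← ⟼-det r q = ↠-det n m rs qs

ren-⟼ : (ρ : Ren Γ Δ) {t u : Tm Γ A} → t ⟼ u → ren ρ t ⟼ ren ρ u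
ren-⟼ ρ (β⟼ {t = t} {u}) = subst (lam (ren (ext ρ) t) · ren ρ u ⟼_) (sym (ren-β ρ u t)) β⟼
ren-⟼ ρ (ξ⟼ r) = ξ⟼ (ren-⟼ ρ r)

ren-↠ : (ρ : Ren Γ Δ) {t u : Tm Γ A} → t ↠ u → ren ρ t ↠ ren ρ u
ren-↠ ρ done     = done
ren-↠ ρ (r ◅ rs) = ren-⟼ ρ r ◅ ren-↠ ρ rs

-- A Kripke logical relation, which will contain ≈: at base type, related terms
-- weak-head reduce to neutral terms with the same head and convertible arguments.
Rel : ∀ {Γ} A → Tm Γ A → Tm Γ A → Set
Rel (ι b) t u = ∃[ t' ] ∃[ u' ] (t ↠ t' × u ↠ u' × t' ~ u')
Rel {Γ} (A ⇒ B) t u = ∀ {Δ} (ρ : Ren Γ Δ) {a b} → Rel A a b → Rel B (ren ρ t · a) (ren ρ u · b)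

Rel-sym : ∀ A {t u : Tm Γ A} → Rel A t u → Rel A u t
Rel-sym (ι b) (_ , _ , r , q , n) = _ , _ , q , r , ~sym n
Rel-sym (A ⇒ B) f ρ r = Rel-sym B (f ρ (Rel-sym A r))

Rel-trans : ∀ A {t u v : Tm Γ A} → Rel A t u → Rel A u v → Rel A t v
Rel-trans (ι b) (_ , _ , r , q , n) (_ , _ , r' , q' , n')
  with refl ← ↠-det (~neutralˡ (~sym n)) (~neutralˡ n') q r' = _ , _ , r , q' , ~trans n n'
-- `g` needs its argument `b` related to itself; this follows from `r` by symmetry and transitivity.
Rel-trans (A ⇒ B) f g ρ r = Rel-trans B (f ρ r) (g ρ (Rel-trans A (Rel-sym A r) r))

Rel-ren : ∀ A (ρ : Ren Γ Δ) {t u : Tm Γ A} → Rel A t u → Rel A (ren ρ t) (ren ρ u)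
Rel-ren (ι b) ρ (_ , _ , r , q , n) = _ , _ , ren-↠ ρ r , ren-↠ ρ q , ren-~ ρ n
Rel-ren (A ⇒ B) ρ {t} {u} f ρ' {a} {b} r =
  subst₂ (λ t u → Rel B (t · a) (u · b))
         (sym (ren-ren (λ _ → refl) t)) (sym (ren-ren (λ _ → refl) u)) (f (λ x → ρ' (ρ x)) r)

Rel-expˡ : ∀ A {t t' u : Tm Γ A} → t ⟼ t' → Rel A t' u → Rel A t u
Rel-expˡ (ι b) r (_ , _ , rs , q , n) = _ , _ , r ◅ rs , q , n
Rel-expˡ (A ⇒ B) r f ρ a = Rel-expˡ B (ξ⟼ (ren-⟼ ρ r)) (f ρ a)

Rel-expʳ : ∀ A {t u u' : Tm Γ A} → u ⟼ u' → Rel A t u' → Rel A t u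
Rel-expʳ A r h = Rel-sym A (Rel-expˡ A r (Rel-sym A h))

-- The two are mutual in the type. At an arrow, `reify` applies the related functions to a fresh
-- variable, obtained from `reflect`, and concludes by η; this is where `Rel` must be stable under
-- renaming. Conversely `reflect` uses `reify` because `~` wants convertible arguments.
reflect : ∀ A {t u : Tm Γ A} → t ~ u → Rel A t u
reify   : ∀ A {t u : Tm Γ A} → Rel A t u → t ≈ u
reflect (ι b) n = _ , _ , done , done , n
reflect (A ⇒ B) n ρ r = reflect B (ren-~ ρ n ~· reify A r)
reify (ι b) (_ , _ , r , q , n) = ≈trans (↠⇒≈ r) (≈trans (~⇒≈ n) (≈sym (↠⇒≈ q)))
reify (A ⇒ B) f = ≈trans η (≈trans (≈lam (reify B (f there (reflect A ~var)))) (≈sym η))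

RelS : Sub Γ Δ → Sub Γ Δ → Set
RelS {Γ} σ τ = ∀ {A} (x : Γ ∋ A) → Rel A (σ x) (τ x)

sub-cons-ren : (σ : Sub Γ Δ) (ρ : Ren Δ Θ) (a : Tm Θ A) (t : Tm (A ∷ Γ) B) →
               sub (sub0 a) (ren (ext ρ) (sub (exts σ) t)) ≡ sub (consS a (λ x → ren ρ (σ x))) t
sub-cons-ren σ ρ a t =
  trans (cong (sub (sub0 a)) (ren-sub (λ _ → refl) t))
        (sub-sub (λ { here → refl
                    ; (there x) → trans (cong (sub (sub0 a)) (ren-ren (λ _ → refl) (σ x)))
                                        (trans (sub-ren (λ _ → refl) (σ x)) (sym (ren-as-sub ρ (σ x)))) }) t)

RelS-cons : ∀ {σ τ : Sub Γ Δ} {a b : Tm Δ A} → Rel A a b → RelS σ τ → RelS (consS a σ) (consS b τ)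
RelS-cons r rs here      = r
RelS-cons r rs (there x) = rs x

Rel-lam : ∀ {σ τ : Sub Γ Δ} {t u : Tm (A ∷ Γ) B} → RelS σ τ →
          (∀ {Θ} {σ' τ' : Sub (A ∷ Γ) Θ} → RelS σ' τ' → Rel B (sub σ' t) (sub τ' u)) →
          Rel (A ⇒ B) (sub σ (lam t)) (sub τ (lam u))
Rel-lam {B = B} {σ = σ} {τ} {t} {u} rs h ρ {a} {b} r =
  Rel-expˡ B β⟼ (Rel-expʳ B β⟼
    (subst₂ (Rel B) (sym (sub-cons-ren σ ρ a t)) (sym (sub-cons-ren τ ρ b u))
      (h (RelS-cons r (λ x → Rel-ren _ ρ (rs x))))))

Rel-app : {t u : Tm Γ (A ⇒ B)} {a b : Tm Γ A} → Rel (A ⇒ B) t u → Rel A a b → Rel B (t · a) (u · b)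
Rel-app {B = B} {t = t} {u} {a} {b} f r =
  subst₂ (λ t u → Rel B (t · a) (u · b)) (ren-id t) (ren-id u) (f (λ x → x) r)

Rel-refl : (t : Tm Γ A) {σ τ : Sub Γ Δ} → RelS σ τ → Rel A (sub σ t) (sub τ t)
Rel-refl (var x) rs = rs x
Rel-refl (con c) rs = reflect _ ~con
Rel-refl (lam t) rs = Rel-lam {t = t} {t} rs (Rel-refl t)
Rel-refl (t · u) rs = Rel-app (Rel-refl t rs) (Rel-refl u rs)

RelS-sym : {σ τ : Sub Γ Δ} → RelS σ τ → RelS τ σ
RelS-sym rs x = Rel-sym _ (rs x)

-- Fundamental lemma, by induction on the conversion, with related substitutions on the two sides to
-- pass under binders. `Rel` is only a partial equivalence, so transitivity uses the first
-- conversion at `σ`, `σ`, related by symmetry and transitivity. For η, one weak-head step of the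
-- expansion gives back the original application.
≈⇒Rel : {t u : Tm Γ A} → t ≈ u → {σ τ : Sub Γ Δ} → RelS σ τ → Rel A (sub σ t) (sub τ u)
≈⇒Rel (≈refl {t = t}) rs = Rel-refl t rs
≈⇒Rel (≈sym e) rs = Rel-sym _ (≈⇒Rel e (RelS-sym rs))
≈⇒Rel (≈trans e f) rs =
  Rel-trans _ (≈⇒Rel e (λ x → Rel-trans _ (rs x) (Rel-sym _ (rs x)))) (≈⇒Rel f rs)
≈⇒Rel (≈lam {t = t} {u} e) rs = Rel-lam {t = t} {u} rs (≈⇒Rel e)
≈⇒Rel (≈app e f) rs = Rel-app (≈⇒Rel e rs) (≈⇒Rel f rs)
≈⇒Rel (β {t = t} {u}) {σ} {τ} rs =
  Rel-expˡ _ β⟼ (subst₂ (Rel _) (sym (sub0-exts σ (sub σ u) t)) (sym (sub-sub0 τ u t))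
    (Rel-refl t (RelS-cons (Rel-refl u rs) rs)))
≈⇒Rel (η {A = A} {B = B} {t = t}) {σ} {τ} rs ρ {a} {b} r =
  Rel-expʳ _ β⟼ (subst (λ u → Rel B (ren ρ (sub σ t) · a) (u · b)) (sym eq) (Rel-refl t rs ρ r))
  where
  eq : sub (sub0 b) (ren (ext ρ) (sub (exts τ) (ren there t))) ≡ ren ρ (sub τ t)
  eq = trans (sub-cons-ren τ ρ b (ren there t))
             (trans (sub-ren (λ _ → refl) t) (sym (ren-sub (λ _ → refl) t)))

-- A neutral term has no weak-head step, so the neutral terms delivered by `Rel` are `t` and `u`
-- themselves. The `Neutral` arguments reduce to the unit type for explicit heads and are then
-- solved silently.
inj : ∀ {b} {t u : Tm Γ (ι b)} → t ≈ u → {_ : Neutral t} {_ : Neutral u} → t ~ u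
inj {t = t} {u} e {n} {m} with ≈⇒Rel e {var} {var} (λ x → reflect _ ~var)
... | _ , _ , r , q , k
  with refl ← neutral-↠ n (subst (_↠ _) (sub-var t) r)
     | refl ← neutral-↠ m (subst (_↠ _) (sub-var u) q) = k

con-inj₁ : ∀ {b} {c : Const (A ⇒ ι b)} {t t' : Tm Σ A} → con c · t ≈ con c · t' → t ≈ t'
con-inj₁ e with inj e
... | _ ~· e₁ = e₁

con-inj₂ : ∀ {b} {c : Const (A ⇒ B ⇒ ι b)} {t t' : Tm Σ A} {u u' : Tm Σ B} →
           con c · t · u ≈ con c · t' · u' → t ≈ t' × u ≈ u'
con-inj₂ e with inj e
... | _ ~· e₁ ~· e₂ = e₁ , e₂

headOf : Tm Σ A → Maybe (∃[ B ] Const B)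
headOf (var x) = nothing
headOf (con c) = just (_ , c)
headOf (lam t) = nothing
headOf (t · u) = headOf t

~⇒headOf : {t u : Tm Σ A} → t ~ u → headOf t ≡ headOf u
~⇒headOf ~var     = refl
~⇒headOf ~con     = refl
~⇒headOf (n ~· _) = ~⇒headOf n

-- Comparing heads as values of `Maybe` lets the coverage checker refute any two distinct constants,
-- so callers only write `λ ()`.
clash : ∀ {b} {X : Set} {t u : Tm Σ (ι b)} → t ≈ u → {_ : Neutral t} {_ : Neutral u} →
        (headOf t ≡ headOf u → ⊥) → X
clash e {n} {m} h = ⊥-elim (h (~⇒headOf (inj e {n} {m})))

-- Substitution in formulas and derivations

subF-subF : ∀ {σ : Sub Γ Δ} {τ : Sub Δ Θ} {υ : Sub Γ Θ} →
            (∀ {A} (x : Γ ∋ A) → sub τ (σ x) ≡ υ x) → (F : Form Γ) → subF τ (subF σ F) ≡ subF υ F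
subF-subF h (atom t)   = cong atom (sub-sub h t)
subF-subF h ⊥F         = refl
subF-subF h ⊤F         = refl
subF-subF h (F ∧F G)   = cong₂ _∧F_ (subF-subF h F) (subF-subF h G)
subF-subF h (F ∨F G)   = cong₂ _∨F_ (subF-subF h F) (subF-subF h G)
subF-subF h (F ⊃F G)   = cong₂ _⊃F_ (subF-subF h F) (subF-subF h G)
subF-subF h (∀F A p F) = cong (∀F A p) (subF-subF (exts-∘ h) F)
subF-subF h (∃F A p F) = cong (∃F A p) (subF-subF (exts-∘ h) F)

subF-id : ∀ {σ : Sub Γ Γ} → (∀ {A} (x : Γ ∋ A) → σ x ≡ var x) → (F : Form Γ) → subF σ F ≡ F
subF-id h (atom t)   = cong atom (sub-id h t)
subF-id h ⊥F         = refl
subF-id h ⊤F         = refl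
subF-id h (F ∧F G)   = cong₂ _∧F_ (subF-id h F) (subF-id h G)
subF-id h (F ∨F G)   = cong₂ _∨F_ (subF-id h F) (subF-id h G)
subF-id h (F ⊃F G)   = cong₂ _⊃F_ (subF-id h F) (subF-id h G)
subF-id h (∀F A p F) = cong (∀F A p) (subF-id (exts-var h) F)
subF-id h (∃F A p F) = cong (∃F A p) (subF-id (exts-var h) F)

subF-var : (F : Form Γ) → subF var F ≡ F
subF-var = subF-id (λ _ → refl)

subF-subF₂ : ∀ {Δ'} {σ : Sub Γ Δ} {τ : Sub Δ Θ} {σ' : Sub Γ Δ'} {τ' : Sub Δ' Θ} →
             (∀ {A} (x : Γ ∋ A) → sub τ (σ x) ≡ sub τ' (σ' x)) → (F : Form Γ) →
             subF τ (subF σ F) ≡ subF τ' (subF σ' F)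
subF-subF₂ h F = trans (subF-subF h F) (sym (subF-subF (λ _ → refl) F))

subF-≈ : (σ : Sub Γ Δ) {F G : Form Γ} → F ≈F G → subF σ F ≈F subF σ G
subF-≈ σ (atom≈ e) = atom≈ (sub-≈ σ e)
subF-≈ σ ⊥≈        = ⊥≈
subF-≈ σ ⊤≈        = ⊤≈
subF-≈ σ (∧≈ e f)  = ∧≈ (subF-≈ σ e) (subF-≈ σ f)
subF-≈ σ (∨≈ e f)  = ∨≈ (subF-≈ σ e) (subF-≈ σ f)
subF-≈ σ (⊃≈ e f)  = ⊃≈ (subF-≈ σ e) (subF-≈ σ f)
subF-≈ σ (∀≈ e)    = ∀≈ (subF-≈ (exts σ) e)
subF-≈ σ (∃≈ e)    = ∃≈ (subF-≈ (exts σ) e)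

subF-cong-≈ : {σ τ : Sub Γ Δ} → (∀ {A} (x : Γ ∋ A) → σ x ≈ τ x) → (F : Form Γ) → subF σ F ≈F subF τ F
subF-cong-≈ h (atom t)   = atom≈ (sub-cong-≈ h t)
subF-cong-≈ h ⊥F         = ⊥≈
subF-cong-≈ h ⊤F         = ⊤≈
subF-cong-≈ h (F ∧F G)   = ∧≈ (subF-cong-≈ h F) (subF-cong-≈ h G)
subF-cong-≈ h (F ∨F G)   = ∨≈ (subF-cong-≈ h F) (subF-cong-≈ h G)
subF-cong-≈ h (F ⊃F G)   = ⊃≈ (subF-cong-≈ h F) (subF-cong-≈ h G)
subF-cong-≈ h (∀F A p F) = ∀≈ (subF-cong-≈ (exts-≈ h) F)
subF-cong-≈ h (∃F A p F) = ∃≈ (subF-cong-≈ (exts-≈ h) F)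

sub0-comm : (σ : Sub Γ Δ) (t : Tm Γ A) (F : Form (A ∷ Γ)) →
            subF (exts σ) F [ sub σ t ]F ≡ subF σ (F [ t ]F)
sub0-comm σ t = subF-subF₂ (λ { here → refl ; (there x) → sub-sub0-wk (sub σ t) (σ x) })

succ-comm : (σ : Sub Γ Δ) (F : Form (N ∷ Γ)) →
            subF (exts σ) (subF succSub F) ≡ subF succSub (subF (exts σ) F)
succ-comm σ = subF-subF₂ (λ { here → refl
                            ; (there x) → trans (ren-as-sub there (σ x)) (sym (sub-ren (λ _ → refl) (σ x))) })

wkF-comm : (σ : Sub Γ Δ) (F : Form Γ) → wkF {A = A} (subF σ F) ≡ subF (exts σ) (wkF F)
wkF-comm σ = subF-subF₂ (λ x → sym (ren-as-sub there (σ x)))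

map-wkF-comm : (σ : Sub Γ Δ) (Π : List (Form Γ)) →
               map (wkF {A = A}) (map (subF σ) Π) ≡ map (subF (exts σ)) (map wkF Π)
map-wkF-comm σ Π = trans (sym (map-∘ Π)) (trans (map-cong (wkF-comm σ) Π) (map-∘ Π))

DefAtom-sub : (σ : Sub Γ Δ) {t : Tm Γ A} → DefAtom t → DefAtom (sub σ t)
DefAtom-sub σ (hd d) = hd d
DefAtom-sub σ (ap d) = ap (DefAtom-sub σ d)

substD : {Π Π' : List (Form Σ)} {D D' : Form Σ} → Π ≡ Π' → D ≡ D' → Σ ⨾ Π ⟶ D → Σ ⨾ Π' ⟶ D'
substD refl refl d = d

-- In the `defL` case a unifier of the instance, composed with `σ`, is a unifier of the original
-- atom, so the premise for it is already among those given.
subD : {Π : List (Form Σ)} {D : Form Σ} (σ : Sub Σ Σ') → Σ ⨾ Π ⟶ D → Σ' ⨾ map (subF σ) Π ⟶ subF σ D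
subD σ ⊥L = ⊥L
subD σ ⊤R = ⊤R
subD σ init = init
subD σ (∧L₁ d) = ∧L₁ (subD σ d)
subD σ (∧L₂ d) = ∧L₂ (subD σ d)
subD σ (∧R d e) = ∧R (subD σ d) (subD σ e)
subD σ (∨L d e) = ∨L (subD σ d) (subD σ e)
subD σ (∨R₁ d) = ∨R₁ (subD σ d)
subD σ (∨R₂ d) = ∨R₂ (subD σ d)
subD σ (⊃L d e) = ⊃L (subD σ d) (subD σ e)
subD σ (⊃R d) = ⊃R (subD σ d)
subD σ (∀L {B = B} t d) = ∀L (sub σ t) (substD (cong (_∷ _) (sym (sub0-comm σ t B))) refl (subD σ d))
subD σ (∀R {Γ = Π} d) = ∀R (substD (sym (map-wkF-comm σ Π)) refl (subD (exts σ) d))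
subD σ (∃L {Γ = Π} {D = D} d) =
  ∃L (substD (cong (_ ∷_) (sym (map-wkF-comm σ Π))) (sym (wkF-comm σ D)) (subD (exts σ) d))
subD σ (∃R {B = B} t d) = ∃R (sub σ t) (substD refl (sym (sub0-comm σ t B)) (subD σ d))
subD σ (contr d) = contr (subD σ d)
subD σ (exch p d) = exch (map⁺ (subF σ) p) (subD σ d)
subD σ (cut {Γ₁ = Π₁} {Π₂} d e) = substD (sym (map-++ (subF σ) Π₁ Π₂)) refl (cut (subD σ d) (subD σ e))
subD σ (convL e d) = convL (subF-≈ σ e) (subD σ d)
subD σ (convR e d) = convR (subF-≈ σ e) (subD σ d)
subD σ natZ = natZ
subD σ (natS d) = natS (subD σ d)
subD σ (ind {t = t} B d₀ dₛ d) =
  ind (subF (exts σ) B)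
      (substD refl (sym (sub0-comm σ Z B)) (subD σ d₀))
      (substD refl (succ-comm σ B) (subD (exts σ) dₛ))
      (substD (cong (_∷ _) (sym (sub0-comm σ t B))) refl (subD σ d))
subD {Σ' = Σ'} {Π = Π} σ (defR c θ d) =
  subst (λ t → Σ' ⨾ map (subF σ) Π ⟶ atom t) (sym (sub-sub (λ _ → refl) (chead c)))
    (defR c (λ x → sub σ (θ x)) (substD refl (subF-subF (λ _ → refl) (cbody c)) (subD σ d)))
subD σ (defL {Γ = Π} {u} {D} a d) =
  defL (DefAtom-sub σ a) λ c Σ″ ns σ' τ e →
    substD (cong (_ ∷_) (sym (trans (sym (map-∘ Π)) (map-cong (subF-subF (λ _ → refl)) Π))))
           (sym (subF-subF (λ _ → refl) D))
           (d c Σ″ ns (λ x → sub σ' (σ x)) τ (subst (_≈ _) (sub-sub (λ _ → refl) u) e))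

identity : {Π : List (Form Σ)} (F : Form Σ) → Σ ⨾ F ∷ Π ⟶ F
identity (atom t) = init
identity ⊥F = ⊥L
identity ⊤F = ⊤R
identity (F ∧F G) = ∧R (∧L₁ (identity F)) (∧L₂ (identity G))
identity (F ∨F G) = ∨L (∨R₁ (identity F)) (∨R₂ (identity G))
identity (F ⊃F G) = ⊃R (exch (shift _ (_ ∷ []) _) (⊃L (identity F) (identity G)))
identity (∀F A p F) =
  ∀R (∀L v0 (substD (cong (_∷ _) (sym (trans (subF-subF (λ { here → refl ; (there x) → refl }) F) (subF-var F))))
                    refl (identity F)))
identity (∃F A p F) =
  ∃L (∃R v0 (substD refl (sym (trans (subF-subF (λ { here → refl ; (there x) → refl }) F) (subF-var F)))
                    (identity F)))

-- The calculus has no weakening rule, but `cut` joins two contexts and `identity` holds in any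
-- context: cutting against an identity that carries `G` adds `G`.
weaken : {Π : List (Form Σ)} {D : Form Σ} (G : Form Σ) → Σ ⨾ Π ⟶ D → Σ ⨾ G ∷ Π ⟶ D
weaken {Π = Π} {D} G d = exch (++-comm Π (G ∷ [])) (cut d (identity D))

contract++ : (Π Ψ : List (Form Σ)) {D : Form Σ} → Σ ⨾ Π ++ (Π ++ Ψ) ⟶ D → Σ ⨾ Π ++ Ψ ⟶ D
contract++ [] Ψ d = d
contract++ (F ∷ Π) Ψ d =
  exch (shift F Π Ψ)
    (contract++ Π (F ∷ Ψ)
      (exch (↭-trans (↭-sym (shift F Π (Π ++ Ψ))) (++⁺ˡ Π (↭-sym (shift F Π Ψ))))
        (contr (exch (prep F (shift F Π (Π ++ Ψ))) d))))

-- Cut with a shared context. Each elimination rule below is a left rule cut against the derivation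
-- of its major premise.
cutΠ : {Π : List (Form Σ)} {F D : Form Σ} → Σ ⨾ Π ⟶ F → Σ ⨾ F ∷ Π ⟶ D → Σ ⨾ Π ⟶ D
cutΠ {Π = Π} d e =
  substD (++-identityʳ Π) refl
    (contract++ Π [] (substD (cong (Π ++_) (sym (++-identityʳ Π))) refl (cut d e)))

-- Natural deduction in higher-order style

infixr 5 _++ₑ_
infix 8 _∣_

-- Substitutions as lists: `mapₑ` computes on them, and their equality requires no function
-- extensionality.
data Env : Ctx → Ctx → Set where
  []  : Env [] Σ
  _∷_ : Tm Σ A → Env Θ Σ → Env (A ∷ Θ) Σ

look : Env Θ Σ → Sub Θ Σ
look (t ∷ ρ) here      = t
look (t ∷ ρ) (there x) = look ρ x

mapₑ : Sub Σ Σ' → Env Θ Σ → Env Θ Σ'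
mapₑ σ []      = []
mapₑ σ (t ∷ ρ) = sub σ t ∷ mapₑ σ ρ

_++ₑ_ : Env Θ Σ → Env Ξ Σ → Env (Θ ++ Ξ) Σ
[]      ++ₑ ρ' = ρ'
(t ∷ ρ) ++ₑ ρ' = t ∷ (ρ ++ₑ ρ')

mapₑ-++ : (σ : Sub Σ Σ') (ρ : Env Θ Σ) (ρ' : Env Ξ Σ) → mapₑ σ (ρ ++ₑ ρ') ≡ mapₑ σ ρ ++ₑ mapₑ σ ρ'
mapₑ-++ σ []      ρ' = refl
mapₑ-++ σ (t ∷ ρ) ρ' = cong (_ ∷_) (mapₑ-++ σ ρ ρ')

mapₑ-mapₑ : (σ : Sub Σ Δ) (τ : Sub Δ Γ) (ρ : Env Θ Σ) → mapₑ τ (mapₑ σ ρ) ≡ mapₑ (λ x → sub τ (σ x)) ρ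
mapₑ-mapₑ σ τ []      = refl
mapₑ-mapₑ σ τ (t ∷ ρ) = cong₂ _∷_ (sub-sub (λ _ → refl) t) (mapₑ-mapₑ σ τ ρ)

mapₑ-var : (ρ : Env Θ Σ) → mapₑ var ρ ≡ ρ
mapₑ-var []      = refl
mapₑ-var (t ∷ ρ) = cong₂ _∷_ (sub-var t) (mapₑ-var ρ)

look-mapₑ : (σ : Sub Σ Σ') (ρ : Env Θ Σ) → ∀ {A} (x : Θ ∋ A) → sub σ (look ρ x) ≡ look (mapₑ σ ρ) x
look-mapₑ σ (t ∷ ρ) here      = refl
look-mapₑ σ (t ∷ ρ) (there x) = look-mapₑ σ ρ x

_∣_ : Form Θ → Env Θ Σ → Form Σ
F ∣ ρ = subF (look ρ) F

subF-∣ : (σ : Sub Σ Σ') (F : Form Θ) (ρ : Env Θ Σ) → subF σ (F ∣ ρ) ≡ F ∣ mapₑ σ ρ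
subF-∣ σ F ρ = subF-subF (look-mapₑ σ ρ) F

inst-∣ : (F : Form (A ∷ Θ)) (ρ : Env Θ Σ) (t : Tm Σ A) → subF (exts (look ρ)) F [ t ]F ≡ F ∣ (t ∷ ρ)
inst-∣ F ρ t = subF-subF (λ { here → refl ; (there x) → sub-sub0-wk t (look ρ x) }) F

subF-cong : {σ τ : Sub Γ Δ} → (∀ {A} (x : Γ ∋ A) → σ x ≡ τ x) → (F : Form Γ) → subF σ F ≡ subF τ F
subF-cong {σ = σ} h F = trans (sym (subF-var (subF σ F))) (subF-subF (λ x → trans (sub-var (σ x)) (h x)) F)

weakenₑ : Env Θ Σ → Env Θ (A ∷ Σ)
weakenₑ = mapₑ (λ x → var (there x))

exts-∣ : (F : Form (A ∷ Θ)) (ρ : Env Θ Σ) → subF (exts (look ρ)) F ≡ F ∣ (v0 ∷ weakenₑ ρ)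
exts-∣ F ρ = subF-cong (λ { here → refl
                          ; (there x) → trans (ren-as-sub there (look ρ x)) (look-mapₑ _ ρ x) }) F

-- Goals keep the formula and its parameters apart, so that a substitution acts on the
-- parameters only and computes once they are given.
infix 8 _∥_
record Goal (Σ : Ctx) : Set where
  constructor _∥_
  field
    {params} : Ctx
    shape    : Form params
    args     : Env params Σ

⌊_⌋ : Goal Σ → Form Σ
⌊ F ∥ ρ ⌋ = F ∣ ρ

mapG : Sub Σ Σ' → Goal Σ → Goal Σ'
mapG σ (F ∥ ρ) = F ∥ mapₑ σ ρ

subF-⌊⌋ : (σ : Sub Σ Σ') (g : Goal Σ) → subF σ ⌊ g ⌋ ≡ ⌊ mapG σ g ⌋
subF-⌊⌋ σ (F ∥ ρ) = subF-∣ σ F ρ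

-- The accessibility relation of the higher-order rules below: eigenvariables may be instantiated
-- and hypotheses added.
record _⟹_ {Σ Σ' : Ctx} (Π : List (Form Σ)) (Π' : List (Form Σ')) : Set where
  field
    su : Sub Σ Σ'
    tr : {D : Form Σ} → Σ ⨾ Π ⟶ D → Σ' ⨾ Π' ⟶ subF su D
open _⟹_ public

infixl 5 _↑_
_↑_ : {Π : List (Form Σ)} {Π' : List (Form Σ')} {t : Tm Σ O} →
      Σ ⨾ Π ⟶ atom t → (f : Π ⟹ Π') → Σ' ⨾ Π' ⟶ atom (sub (su f) t)
d ↑ f = tr f d

trF : {Π : List (Form Σ)} {Π' : List (Form Σ')} (F : Form Θ) (ρ : Env Θ Σ) (f : Π ⟹ Π') →
      Σ ⨾ Π ⟶ F ∣ ρ → Σ' ⨾ Π' ⟶ F ∣ mapₑ (su f) ρ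
trF F ρ f d = substD refl (subF-∣ (su f) F ρ) (tr f d)

infixl 6 _⨟_
_⨟_ : ∀ {Σ₁ Σ₂ Σ₃} {Π₁ : List (Form Σ₁)} {Π₂ : List (Form Σ₂)} {Π₃ : List (Form Σ₃)} →
      Π₁ ⟹ Π₂ → Π₂ ⟹ Π₃ → Π₁ ⟹ Π₃
su (f ⨟ g) x = sub (su g) (su f x)
tr (f ⨟ g) {D} d = substD refl (subF-subF (λ _ → refl) D) (tr g (tr f d))

idE : {Π : List (Form Σ)} → Π ⟹ Π
su idE = var
tr idE {D} d = substD refl (sym (subF-var D)) d

hypE : {Π : List (Form Σ)} (σ : Sub Σ Σ') (G : Form Σ') → Π ⟹ (G ∷ map (subF σ) Π)
su (hypE σ G) = σ
tr (hypE σ G) d = weaken G (subD σ d)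

assumeE : {Π : List (Form Σ)} (G : Form Σ) → Π ⟹ (G ∷ Π)
su (assumeE G) = var
tr (assumeE G) {D} d = weaken G (tr idE d)

module _ {Σ : Ctx} {Π : List (Form Σ)} where

  -- The premise is an Agda function over all accessible sequents, instantiated at a weakening and
  -- its fresh variable. Proofs can thus name eigenvariables by Agda variables instead of indices.
  ∀I : {p : NoO A} (F : Form (A ∷ Θ)) (ρ : Env Θ Σ) →
       (∀ {Σ'} {Π' : List (Form Σ')} (f : Π ⟹ Π') (t : Tm Σ' A) → Σ' ⨾ Π' ⟶ F ∣ (t ∷ mapₑ (su f) ρ)) →
       Σ ⨾ Π ⟶ ∀F A p F ∣ ρ
  ∀I F ρ h = ∀R (substD refl (sym (exts-∣ F ρ)) (h wk v0))
    where
    wk : Π ⟹ map wkF Π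
    su wk x = var (there x)
    tr wk   = subD _

  ∀E : {p : NoO A} (F : Form (A ∷ Θ)) (ρ : Env Θ Σ) → Σ ⨾ Π ⟶ ∀F A p F ∣ ρ → (t : Tm Σ A) → Σ ⨾ Π ⟶ F ∣ (t ∷ ρ)
  ∀E F ρ d t = cutΠ d (∀L t (substD (cong (_∷ _) (sym (inst-∣ F ρ t))) refl (identity _)))

  ∃I : {p : NoO A} (F : Form (A ∷ Θ)) (ρ : Env Θ Σ) (t : Tm Σ A) → Σ ⨾ Π ⟶ F ∣ (t ∷ ρ) → Σ ⨾ Π ⟶ ∃F A p F ∣ ρ
  ∃I F ρ t d = ∃R t (substD refl (sym (inst-∣ F ρ t)) d)

  ∃E : {p : NoO A} (F : Form (A ∷ Θ)) (ρ : Env Θ Σ) (g : Goal Σ) → Σ ⨾ Π ⟶ ∃F A p F ∣ ρ →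
       (∀ {Σ'} {Π' : List (Form Σ')} (f : Π ⟹ Π') (t : Tm Σ' A) →
        Σ' ⨾ Π' ⟶ F ∣ (t ∷ mapₑ (su f) ρ) → Σ' ⨾ Π' ⟶ ⌊ mapG (su f) g ⌋) →
       Σ ⨾ Π ⟶ ⌊ g ⌋
  ∃E F ρ g d h =
    cutΠ d (∃L (substD refl (sym (subF-⌊⌋ _ g))
      (h (hypE _ _) v0 (substD refl (exts-∣ F ρ) (identity _)))))

  ⊃I : (F G : Form Θ) (ρ : Env Θ Σ) →
       (∀ {Σ'} {Π' : List (Form Σ')} (f : Π ⟹ Π') → Σ' ⨾ Π' ⟶ F ∣ mapₑ (su f) ρ → Σ' ⨾ Π' ⟶ G ∣ mapₑ (su f) ρ) →
       Σ ⨾ Π ⟶ (F ⊃F G) ∣ ρ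
  ⊃I F G ρ h = ⊃R (substD refl (cong (G ∣_) (mapₑ-var ρ))
    (h (assumeE (F ∣ ρ)) (substD refl (cong (F ∣_) (sym (mapₑ-var ρ))) (identity _))))

  ⊃E : {F G : Form Σ} → Σ ⨾ Π ⟶ F ⊃F G → Σ ⨾ Π ⟶ F → Σ ⨾ Π ⟶ G
  ⊃E d e = cutΠ d (⊃L e (identity _))

  ∧E₁ : {F G : Form Σ} → Σ ⨾ Π ⟶ F ∧F G → Σ ⨾ Π ⟶ F
  ∧E₁ d = cutΠ d (∧L₁ (identity _))

  ∧E₂ : {F G : Form Σ} → Σ ⨾ Π ⟶ F ∧F G → Σ ⨾ Π ⟶ G
  ∧E₂ d = cutΠ d (∧L₂ (identity _))

NoOs : Ctx → Set
NoOs []      = ⊤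
NoOs (A ∷ Θ) = NoO A × NoOs Θ

-- The head of `Θ` is bound innermost, so `v0` denotes the head and the body lives directly over
-- `Θ ++ Ξ`. Environments of bound variables therefore list the innermost variable first.
∀* : ∀ Θ → {NoOs Θ} → Form (Θ ++ Ξ) → Form Ξ
∀* []      F = F
∀* (A ∷ Θ) {p , ps} F = ∀* Θ {ps} (∀F A p F)

infixr 4 _⊃*_
_⊃*_ : List (Form Θ) → Form Θ → Form Θ
[]       ⊃* G = G
(F ∷ Fs) ⊃* G = F ⊃F (Fs ⊃* G)

_⨾_⟶*_∣_ : ∀ Σ → List (Form Σ) → List (Form Θ) → Env Θ Σ → Set
Σ ⨾ Π ⟶* Fs ∣ ρ = All (λ F → Σ ⨾ Π ⟶ F ∣ ρ) Fs

∀*I : ∀ Θ {ps : NoOs Θ} {Π : List (Form Σ)} (F : Form (Θ ++ Ξ)) (ρ : Env Ξ Σ) →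
      (∀ {Σ'} {Π' : List (Form Σ')} (f : Π ⟹ Π') (ts : Env Θ Σ') → Σ' ⨾ Π' ⟶ F ∣ (ts ++ₑ mapₑ (su f) ρ)) →
      Σ ⨾ Π ⟶ ∀* Θ {ps} F ∣ ρ
∀*I [] F ρ h = substD refl (cong (F ∣_) (mapₑ-var ρ)) (h idE [])
∀*I (A ∷ Θ) F ρ h = ∀*I Θ (∀F A _ F) ρ λ f ts → ∀I F (ts ++ₑ mapₑ (su f) ρ) λ g t →
  substD refl (cong (λ ρ' → F ∣ (t ∷ ρ'))
                    (trans (cong (mapₑ (su g) ts ++ₑ_) (sym (mapₑ-mapₑ (su f) (su g) ρ)))
                           (sym (mapₑ-++ (su g) ts (mapₑ (su f) ρ)))))
    (h (f ⨟ g) (t ∷ mapₑ (su g) ts))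

∀*E : ∀ Θ {ps : NoOs Θ} {Π : List (Form Σ)} (F : Form (Θ ++ Ξ)) (ρ : Env Ξ Σ) →
      Σ ⨾ Π ⟶ ∀* Θ {ps} F ∣ ρ → (ts : Env Θ Σ) → Σ ⨾ Π ⟶ F ∣ (ts ++ₑ ρ)
∀*E [] F ρ d [] = d
∀*E (A ∷ Θ) F ρ d (t ∷ ts) = ∀E F (ts ++ₑ ρ) (∀*E Θ (∀F A _ F) ρ d ts) t

⊃*I : {Π : List (Form Σ)} (Fs : List (Form Θ)) (G : Form Θ) (ρ : Env Θ Σ) →
      (∀ {Σ'} {Π' : List (Form Σ')} (f : Π ⟹ Π') →
       Σ' ⨾ Π' ⟶* Fs ∣ mapₑ (su f) ρ → Σ' ⨾ Π' ⟶ G ∣ mapₑ (su f) ρ) →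
      Σ ⨾ Π ⟶ (Fs ⊃* G) ∣ ρ
⊃*I [] G ρ h = substD refl (cong (G ∣_) (mapₑ-var ρ)) (h idE [])
⊃*I (F ∷ Fs) G ρ h = ⊃I F (Fs ⊃* G) ρ λ f d → ⊃*I Fs G (mapₑ (su f) ρ) λ g ds →
  substD refl (cong (G ∣_) (sym (mapₑ-mapₑ (su f) (su g) ρ)))
    (h (f ⨟ g) (subst (λ ρ' → All (λ F → _ ⨾ _ ⟶ F ∣ ρ') (F ∷ Fs)) (mapₑ-mapₑ (su f) (su g) ρ) (trF F (mapₑ (su f) ρ) g d ∷ ds)))

⊃*E : {Π : List (Form Σ)} (Fs : List (Form Θ)) {G : Form Θ} (ρ : Env Θ Σ) →
      Σ ⨾ Π ⟶ (Fs ⊃* G) ∣ ρ → Σ ⨾ Π ⟶* Fs ∣ ρ → Σ ⨾ Π ⟶ G ∣ ρ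
⊃*E [] ρ d [] = d
⊃*E (F ∷ Fs) ρ d (e ∷ es) = ⊃*E Fs ρ (⊃E d e) es

-- A lemma proved by `ind` must be a formula of the calculus, not an Agda function. A `Rule` denotes
-- such a formula, with `intros` and `apply` translating to and from functions on derivations.
record Rule (Ξ : Ctx) : Set where
  constructor rule
  field
    bound    : Ctx
    {noOs}   : NoOs bound
    premises : List (Form (bound ++ Ξ))
    concl    : Form (bound ++ Ξ)

⟦_⟧ : Rule Ξ → Form Ξ
⟦ rule Θ {ps} Fs G ⟧ = ∀* Θ {ps} (Fs ⊃* G)

intros : {Π : List (Form Σ)} (r : Rule Ξ) (ρ : Env Ξ Σ) → let open Rule r in
         (∀ {Σ'} {Π' : List (Form Σ')} (f : Π ⟹ Π') (ts : Env bound Σ') →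
          Σ' ⨾ Π' ⟶* premises ∣ (ts ++ₑ mapₑ (su f) ρ) → Σ' ⨾ Π' ⟶ concl ∣ (ts ++ₑ mapₑ (su f) ρ)) →
         Σ ⨾ Π ⟶ ⟦ r ⟧ ∣ ρ
intros (rule Θ Fs G) ρ h = ∀*I Θ (Fs ⊃* G) ρ λ f ts → ⊃*I Fs G (ts ++ₑ mapₑ (su f) ρ) λ g ds →
  subst (λ ρ' → _ ⨾ _ ⟶* Fs ∣ ρ' → _ ⨾ _ ⟶ G ∣ ρ')
        (trans (cong (mapₑ (su g) ts ++ₑ_) (sym (mapₑ-mapₑ (su f) (su g) ρ)))
               (sym (mapₑ-++ (su g) ts (mapₑ (su f) ρ))))
        (h (f ⨟ g) (mapₑ (su g) ts)) ds

apply : {Π : List (Form Σ)} (r : Rule Ξ) (ρ : Env Ξ Σ) → let open Rule r in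
        Σ ⨾ Π ⟶ ⟦ r ⟧ ∣ ρ → (ts : Env bound Σ) →
        Σ ⨾ Π ⟶* premises ∣ (ts ++ₑ ρ) → Σ ⨾ Π ⟶ concl ∣ (ts ++ₑ ρ)
apply (rule Θ Fs G) ρ d ts = ⊃*E Fs (ts ++ₑ ρ) (∀*E Θ (Fs ⊃* G) ρ d ts)

-- Elimination of defined atoms and induction on `nat`

neutral-chead : ∀ c (τ : Sub (cctx c) Σ) → Neutral (sub τ (chead c))
neutral-chead c-eq      τ = tt
neutral-chead c-sum0    τ = tt
neutral-chead c-sumS    τ = tt
neutral-chead c-lt0     τ = tt
neutral-chead c-ltS     τ = tt
neutral-chead c-leRefl  τ = tt
neutral-chead c-leLt    τ = tt
neutral-chead c-len0    τ = tt
neutral-chead c-lenS    τ = tt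
neutral-chead c-list    τ = tt
neutral-chead c-elem1   τ = tt
neutral-chead c-elem2   τ = tt
neutral-chead c-split0  τ = tt
neutral-chead c-split1  τ = tt
neutral-chead c-split2  τ = tt
neutral-chead c-perm0   τ = tt
neutral-chead c-permS   τ = tt
neutral-chead c-seqAtom τ = tt
neutral-chead c-seqTT   τ = tt
neutral-chead c-seqAnd  τ = tt
neutral-chead c-seqImp  τ = tt
neutral-chead c-seqAll  τ = tt
neutral-chead c-seqBack τ = tt
neutral-chead c-tyAbs   τ = tt
neutral-chead c-tyApp   τ = tt
neutral-chead c-evAbs   τ = tt
neutral-chead c-evApp   τ = tt
neutral-chead c-stBeta  τ = tt
neutral-chead c-stApp   τ = tt
neutral-chead c-stsRefl τ = tt
neutral-chead c-stsStep τ = tt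
neutral-chead c-equiv   τ = tt

DefAtom-neutral : {t : Tm Σ A} → DefAtom t → Neutral t
DefAtom-neutral (hd _) = tt
DefAtom-neutral (ap d) = DefAtom-neutral d

headOf-sub : (σ : Sub Σ Σ') {t : Tm Σ A} → DefAtom t → headOf (sub σ t) ≡ headOf t
headOf-sub σ (hd _) = refl
headOf-sub σ (ap d) = headOf-sub σ d

-- The equation between heads follows from the next premise; matching on it discards the clauses of other predicates.
defE : {Π : List (Form Σ)} {u : Tm Σ O} → DefAtom u → (g : Goal Σ) → Σ ⨾ Π ⟶ atom u →
       (∀ {Σ'} {Π' : List (Form Σ')} (f : Π ⟹ Π') (c : Clause) (τ : Sub (cctx c) Σ') →
        headOf (sub τ (chead c)) ≡ headOf u →
        sub (su f) u ~ sub τ (chead c) → Σ' ⨾ Π' ⟶ subF τ (cbody c) → Σ' ⨾ Π' ⟶ ⌊ mapG (su f) g ⌋) →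
       Σ ⨾ Π ⟶ ⌊ g ⌋
defE a g d h = cutΠ d (defL a λ c Σ' _ σ τ e →
  let n = inj e {DefAtom-neutral (DefAtom-sub σ a)} {neutral-chead c τ} in
  substD refl (sym (subF-⌊⌋ σ g))
    (h (hypE σ _) c τ (trans (sym (~⇒headOf n)) (headOf-sub σ a)) n (identity _)))

-- The two inductive premises of `ind` discard the context. Hence the induction variable is the only
-- parameter of `P`, and everything else that varies, further `nat` assumptions included, is put
-- inside `P`.
natI : (P : Form (N ∷ [])) →
       (∀ {Σ} {Π : List (Form Σ)} → Σ ⨾ Π ⟶ P ∣ (Z ∷ [])) →
       (∀ {Σ} {Π : List (Form Σ)} {t : Tm Σ N} → Σ ⨾ Π ⟶ P ∣ (t ∷ []) → Σ ⨾ Π ⟶ P ∣ (S t ∷ [])) →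
       {Π : List (Form Σ)} {t : Tm Σ N} → Σ ⨾ Π ⟶ atom (con nat · t) → Σ ⨾ Π ⟶ P ∣ (t ∷ [])
natI P d₀ dₛ {t = t} d = cutΠ d (ind (P ∣ (v0 ∷ []))
  (substD refl (sym (subF-∣ (sub0 Z) P (v0 ∷ []))) d₀)
  (substD refl (sym (subF-∣ succSub P (v0 ∷ []))) (dₛ (identity _)))
  (substD (cong (_∷ _) (sym (subF-∣ (sub0 t) P (v0 ∷ [])))) refl (identity _)))

conv₁ : {Π : List (Form Σ)} (P : Form (A ∷ [])) {t u : Tm Σ A} → t ≈ u → Σ ⨾ Π ⟶ P ∣ (t ∷ []) → Σ ⨾ Π ⟶ P ∣ (u ∷ [])
conv₁ P e = convR (subF-cong-≈ (λ { here → e }) P)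

data _Pred_ {Σ : Ctx} (t u : Tm Σ N) : Set where
  one : t ≈ S u → t Pred u
  two : t ≈ S (S u) → t Pred u

-- Induction with the hypothesis available at the predecessor and at its predecessor:
-- a backchaining step followed by a conjunction decreases the index by two.
natI₂ : (P : Form (N ∷ [])) →
        (∀ {Σ} {Π : List (Form Σ)} (t : Tm Σ N) →
         (∀ {Σ'} {Π' : List (Form Σ')} (f : Π ⟹ Π') {u} → sub (su f) t Pred u → Σ' ⨾ Π' ⟶ P ∣ (u ∷ [])) →
         Σ ⨾ Π ⟶ P ∣ (t ∷ [])) →
        {Π : List (Form Σ)} {t : Tm Σ N} → Σ ⨾ Π ⟶ atom (con nat · t) → Σ ⨾ Π ⟶ P ∣ (t ∷ [])
-- Ordinary induction on the conjunction of `P` at k and at `S k`. At `Z` there is no predecessor,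
-- and at `S Z` only `one` is possible.
natI₂ P h d = ∧E₁ (natI (P ∧F subF succSub P)
  (∧R p₀ (next _ (h (S Z) λ { f (one e) → here₁ f e p₀ ; f (two e) → clash (con-inj₁ e) λ () })))
  (λ dd → ∧R (prev _ (∧E₂ dd))
    (next _ (h _ λ { f (one e) → here₁ f e (prev _ (∧E₂ dd))
                   ; f (two e) → conv₁ P (con-inj₁ (con-inj₁ e)) (trF P (_ ∷ []) f (∧E₁ dd)) })))
  d)
  where
  next : ∀ {Σ} {Π : List (Form Σ)} (t : Tm Σ N) → Σ ⨾ Π ⟶ P ∣ (S t ∷ []) → Σ ⨾ Π ⟶ subF succSub P ∣ (t ∷ [])
  next t = substD refl (sym (subF-subF (λ { here → refl }) P))
  prev : ∀ {Σ} {Π : List (Form Σ)} (t : Tm Σ N) → Σ ⨾ Π ⟶ subF succSub P ∣ (t ∷ []) → Σ ⨾ Π ⟶ P ∣ (S t ∷ [])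
  prev t = substD refl (subF-subF (λ { here → refl }) P)
  here₁ : ∀ {Σ Σ'} {Π : List (Form Σ)} {Π' : List (Form Σ')} (f : Π ⟹ Π') {t u} →
          sub (su f) (S t) ≈ S u → Σ ⨾ Π ⟶ P ∣ (t ∷ []) → Σ' ⨾ Π' ⟶ P ∣ (u ∷ [])
  here₁ f e d = conv₁ P (con-inj₁ e) (trF P (_ ∷ []) f d)
  p₀ : ∀ {Σ} {Π : List (Form Σ)} → Σ ⨾ Π ⟶ P ∣ (Z ∷ [])
  p₀ = h Z λ { f (one e) → clash e λ () ; f (two e) → clash e λ () }

v4 : ∀ {D E} → Tm (E ∷ D ∷ C ∷ B ∷ A ∷ Γ) A
v4 = var (there (there (there (there here))))
v5 : ∀ {D E F} → Tm (F ∷ E ∷ D ∷ C ∷ B ∷ A ∷ Γ) A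
v5 = var (there (there (there (there (there here)))))

Nat : Tm Σ N → Form Σ
Nat k = atom (con nat · k)
Seq : Tm Σ N → Tm Σ L → Tm Σ PRP → Form Σ
Seq k l b = atom (con seq · k · l · b)
Prog : Tm Σ ATM → Tm Σ PRP → Form Σ
Prog a b = atom (con prog · a · b)
Elem : Tm Σ ATM → Tm Σ L → Form Σ
Elem x l = atom (con element · x · l)

defI : (c : Clause) (ρ : Env (cctx c) Σ) → Σ ⨾ Π ⟶ cbody c ∣ ρ → Σ ⨾ Π ⟶ atom (sub (look ρ) (chead c))
defI c ρ = defR c (look ρ)

at : Tm Σ O → Goal Σ
at t = atom v0 ∥ (t ∷ [])

convSeq : {k k' : Tm Σ N} {l l' : Tm Σ L} {b b' : Tm Σ PRP} → k ≈ k' → l ≈ l' → b ≈ b' →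
          Σ ⨾ Π ⟶ Seq k l b → Σ ⨾ Π ⟶ Seq k' l' b'
convSeq e₁ e₂ e₃ = convR (atom≈ (≈app (≈app (≈app ≈refl e₁) e₂) e₃))

convElem : {x x' : Tm Σ ATM} {l l' : Tm Σ L} → x ≈ x' → l ≈ l' → Σ ⨾ Π ⟶ Elem x l → Σ ⨾ Π ⟶ Elem x' l'
convElem e₁ e₂ = convR (atom≈ (≈app (≈app ≈refl e₁) e₂))

convNat : {k k' : Tm Σ N} → k ≈ k' → Σ ⨾ Π ⟶ Nat k → Σ ⨾ Π ⟶ Nat k'
convNat e = convR (atom≈ (≈app ≈refl e))

-- The clauses that can introduce an atom of a given predicate, up to conversion

data ElemView {Σ : Ctx} (Π : List (Form Σ)) (x : Tm Σ ATM) (l : Tm Σ L) : Set where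
  vHere  : ∀ {m} → l ≈ x ∷ₜ m → ElemView Π x l
  vThere : ∀ {y m} → l ≈ y ∷ₜ m → Σ ⨾ Π ⟶ Elem x m → ElemView Π x l

elemE : (g : Goal Σ) {x : Tm Σ ATM} {l : Tm Σ L} → Σ ⨾ Π ⟶ Elem x l →
        (∀ {Σ'} {Π' : List (Form Σ')} (f : Π ⟹ Π') → ElemView Π' (sub (su f) x) (sub (su f) l) →
         Σ' ⨾ Π' ⟶ ⌊ mapG (su f) g ⌋) →
        Σ ⨾ Π ⟶ ⌊ g ⌋
elemE g d h = defE (ap (ap (hd d-element))) g d λ f c τ q n b → h f (view c τ q n b)
  where
  view : ∀ {Σ} {Π : List (Form Σ)} {x l} (c : Clause) (τ : Sub (cctx c) Σ) → headOf (sub τ (chead c)) ≡ just (_ , element) →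
         con element · x · l ~ sub τ (chead c) → Σ ⨾ Π ⟶ subF τ (cbody c) → ElemView Π x l
  view c-elem1 τ refl (~con ~· e₁ ~· e₂) b = vHere (≈trans e₂ (≈app (≈app ≈refl (≈sym e₁)) ≈refl))
  view c-elem2 τ refl (~con ~· e₁ ~· e₂) b = vThere e₂ (convElem (≈sym e₁) ≈refl b)

∀body : Form (I ∷ N ∷ L ∷ (I ⇒ PRP) ∷ [])
∀body = Seq v1 v2 (v3 · v0)

∃body : Form (PRP ∷ N ∷ L ∷ ATM ∷ [])
∃body = Prog v3 v0 ∧F Seq v1 v2 v0

-- The list of the clause is converted back to `l` in the premises. `vAtom` keeps the equation
-- showing that `l` is a cons, by which it is refuted when `l` is `NIL`.
data SeqView {Σ : Ctx} (Π : List (Form Σ)) (k : Tm Σ N) (l : Tm Σ L) (b : Tm Σ PRP) : Set where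
  vAtom : ∀ {y m x} → l ≈ y ∷ₜ m → b ≈ ⟨ x ⟩ → Σ ⨾ Π ⟶ Elem x l → SeqView Π k l b
  vTT   : b ≈ con ttP → SeqView Π k l b
  vAnd  : ∀ {k' b₁ b₂} → k ≈ S k' → b ≈ b₁ & b₂ → Σ ⨾ Π ⟶ Seq k' l b₁ → Σ ⨾ Π ⟶ Seq k' l b₂ → SeqView Π k l b
  vImp  : ∀ {k' a b₁} → k ≈ S k' → b ≈ con impP · a · b₁ → Σ ⨾ Π ⟶ Seq k' (a ∷ₜ l) b₁ → SeqView Π k l b
  vAll  : ∀ {k' r} → k ≈ S k' → b ≈ con allP · r → Σ ⨾ Π ⟶ ∀F I tt ∀body ∣ (k' ∷ l ∷ r ∷ []) → SeqView Π k l b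
  vBack : ∀ {k' a} → k ≈ S k' → b ≈ ⟨ a ⟩ → Σ ⨾ Π ⟶ ∃F PRP tt ∃body ∣ (k' ∷ l ∷ a ∷ []) → SeqView Π k l b

seqE : (g : Goal Σ) {k : Tm Σ N} {l : Tm Σ L} {b : Tm Σ PRP} → Σ ⨾ Π ⟶ Seq k l b →
       (∀ {Σ'} {Π' : List (Form Σ')} (f : Π ⟹ Π') → SeqView Π' (sub (su f) k) (sub (su f) l) (sub (su f) b) →
        Σ' ⨾ Π' ⟶ ⌊ mapG (su f) g ⌋) →
       Σ ⨾ Π ⟶ ⌊ g ⌋
seqE g d h = defE (ap (ap (ap (hd d-seq)))) g d λ f c τ q n d' → h f (view c τ q n d')
  where
  conv-l : ∀ {Σ A} {Π : List (Form Σ)} (F : Form (N ∷ L ∷ A ∷ [])) {k l l' t} → l ≈ l' →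
           Σ ⨾ Π ⟶ F ∣ (k ∷ l' ∷ t ∷ []) → Σ ⨾ Π ⟶ F ∣ (k ∷ l ∷ t ∷ [])
  conv-l F e = convR (subF-cong-≈ (λ { here → ≈refl ; (there here) → ≈sym e ; (there (there here)) → ≈refl }) F)
  view : ∀ {Σ} {Π : List (Form Σ)} {k l b} (c : Clause) (τ : Sub (cctx c) Σ) → headOf (sub τ (chead c)) ≡ just (_ , seq) →
         con seq · k · l · b ~ sub τ (chead c) → Σ ⨾ Π ⟶ subF τ (cbody c) → SeqView Π k l b
  view c-seqAtom τ refl (~con ~· _ ~· e₂ ~· e₃) d = vAtom e₂ e₃ (convElem ≈refl (≈sym e₂) d)
  view c-seqTT   τ refl (~con ~· _ ~· _ ~· e₃) d = vTT e₃
  view c-seqAnd  τ refl (~con ~· e₁ ~· e₂ ~· e₃) d =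
    vAnd e₁ e₃ (convSeq ≈refl (≈sym e₂) ≈refl (∧E₁ d)) (convSeq ≈refl (≈sym e₂) ≈refl (∧E₂ d))
  view c-seqImp  τ refl (~con ~· e₁ ~· e₂ ~· e₃) d = vImp e₁ e₃ (convSeq ≈refl (≈app ≈refl (≈sym e₂)) ≈refl d)
  view c-seqAll  τ refl (~con ~· e₁ ~· e₂ ~· e₃) d = vAll e₁ e₃ (conv-l (∀F I tt ∀body) {τ here} {_} {τ (there here)} {τ (there (there here))} e₂ d)
  view c-seqBack τ refl (~con ~· e₁ ~· e₂ ~· e₃) d = vBack e₁ e₃ (conv-l (∃F PRP tt ∃body) {τ here} {_} {τ (there here)} {τ (there (there here))} e₂ d)

data ProgView {Σ : Ctx} (a : Tm Σ ATM) (b : Tm Σ PRP) : Set where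
  vTyAbs   : ∀ {r t u} → a ≈ con typeof · (con absC · r) · (con arr · t · u) →
             b ≈ con allP · lam (con impP · (con typeof · v0 · ren there t) · ⟨ con typeof · (ren there r · v0) · ren there u ⟩) →
             ProgView a b
  vTyApp   : ∀ {m n t u} → a ≈ con typeof · (con appC · m · n) · t →
             b ≈ ⟨ con typeof · m · (con arr · u · t) ⟩ & ⟨ con typeof · n · u ⟩ → ProgView a b
  vEvAbs   : ∀ {r} → a ≈ con evalC · (con absC · r) · (con absC · r) → ProgView a b
  vEvApp   : ∀ {m n v r} → a ≈ con evalC · (con appC · m · n) · v →
             b ≈ ⟨ con evalC · m · (con absC · r) ⟩ & ⟨ con evalC · (r · n) · v ⟩ → ProgView a b
  vStBeta  : ∀ {r m} → a ≈ con stepC · (con appC · (con absC · r) · m) · (r · m) → ProgView a b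
  vStApp   : ∀ {m n m'} → a ≈ con stepC · (con appC · m · n) · (con appC · m' · n) → b ≈ ⟨ con stepC · m · m' ⟩ → ProgView a b
  vStsRefl : ∀ {m} → a ≈ con stepsC · m · m → ProgView a b
  vStsStep : ∀ {m n m'} → a ≈ con stepsC · m · n → b ≈ ⟨ con stepC · m · m' ⟩ & ⟨ con stepsC · m' · n ⟩ → ProgView a b

progE : (g : Goal Σ) {a : Tm Σ ATM} {b : Tm Σ PRP} → Σ ⨾ Π ⟶ Prog a b →
        (∀ {Σ'} {Π' : List (Form Σ')} (f : Π ⟹ Π') → ProgView (sub (su f) a) (sub (su f) b) →
         Σ' ⨾ Π' ⟶ ⌊ mapG (su f) g ⌋) →
        Σ ⨾ Π ⟶ ⌊ g ⌋
progE g d h = defE (ap (ap (hd d-prog))) g d λ f c τ q n _ → h f (view c τ q n)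
  where
  view : ∀ {Σ} {a b} (c : Clause) (τ : Sub (cctx c) Σ) → headOf (sub τ (chead c)) ≡ just (_ , prog) →
         con prog · a · b ~ sub τ (chead c) → ProgView a b
  view c-tyAbs   τ refl (~con ~· e₁ ~· e₂) = vTyAbs e₁ e₂
  view c-tyApp   τ refl (~con ~· e₁ ~· e₂) = vTyApp e₁ e₂
  view c-evAbs   τ refl (~con ~· e₁ ~· e₂) = vEvAbs e₁
  view c-evApp   τ refl (~con ~· e₁ ~· e₂) = vEvApp e₁ e₂
  view c-stBeta  τ refl (~con ~· e₁ ~· e₂) = vStBeta e₁
  view c-stApp   τ refl (~con ~· e₁ ~· e₂) = vStApp e₁ e₂
  view c-stsRefl τ refl (~con ~· e₁ ~· e₂) = vStsRefl e₁
  view c-stsStep τ refl (~con ~· e₁ ~· e₂) = vStsStep e₁ e₂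

eqNE : (g : Goal Σ) {k k' : Tm Σ N} → Σ ⨾ Π ⟶ atom (con eqN · k · k') →
       (∀ {Σ'} {Π' : List (Form Σ')} (f : Π ⟹ Π') → sub (su f) k ≈ sub (su f) k' → Σ' ⨾ Π' ⟶ ⌊ mapG (su f) g ⌋) →
       Σ ⨾ Π ⟶ ⌊ g ⌋
eqNE g d h = defE (ap (ap (hd d-eqN))) g d λ f c τ q n _ → h f (view c τ q n)
  where
  view : ∀ {Σ k k'} (c : Clause) (τ : Sub (cctx c) Σ) → headOf (sub τ (chead c)) ≡ just (_ , eqN) →
         con eqN · k · k' ~ sub τ (chead c) → k ≈ k'
  view c-eq τ refl (~con ~· e₁ ~· e₂) = ≈trans e₁ (≈sym e₂)

eqvE : (g : Goal Σ) {m n : Tm Σ I} → Σ ⨾ Π ⟶ atom (con eqv · m · n) →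
       (∀ {Σ'} {Π' : List (Form Σ')} (f : Π ⟹ Π') → sub (su f) m ≈ sub (su f) n → Σ' ⨾ Π' ⟶ ⌊ mapG (su f) g ⌋) →
       Σ ⨾ Π ⟶ ⌊ g ⌋
eqvE g d h = defE (ap (ap (hd d-eqv))) g d λ f c τ q n _ → h f (view c τ q n)
  where
  view : ∀ {Σ m n} (c : Clause) (τ : Sub (cctx c) Σ) → headOf (sub τ (chead c)) ≡ just (_ , eqv) →
         con eqv · m · n ~ sub τ (chead c) → m ≈ n
  view c-equiv τ refl (~con ~· e₁ ~· e₂) = ≈trans e₁ (≈sym e₂)

-- Weakening, monotonicity in the index, and cut for the object logic

inclR : Rule (L ∷ L ∷ [])
inclR = rule (ATM ∷ []) (Elem v0 v1 ∷ []) (Elem v0 v2)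

-- At (j, l, l'): every element of l has a proof of index j from each extension of l'.  Allowing
-- extensions keeps this stable when ⇒ adds a hypothesis to both lists.
coverR : Rule (N ∷ L ∷ L ∷ [])
coverR = rule (ATM ∷ L ∷ []) (Elem v0 v3 ∷ ⟦ inclR ⟧ ∣ (v4 ∷ v1 ∷ []) ∷ []) (Seq v2 v1 ⟨ v0 ⟩)

-- At (j, k, k'): replacing hypotheses by proofs of index j turns
-- proofs of index k into proofs of index k'.  For j = z it is weakening
-- together with raising the index, since an atom provable at index z is a hypothesis.
substR : Rule (N ∷ N ∷ N ∷ [])
substR = rule (L ∷ L ∷ PRP ∷ []) (⟦ coverR ⟧ ∣ (v3 ∷ v0 ∷ v1 ∷ []) ∷ Seq v4 v0 v2 ∷ []) (Seq v5 v1 v2)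

-- Needed at the leaves: the replacing proof has index j and the leaf another one. Leaves are
-- atomic, which makes the case j = z provable before raising in general.
raiseR : Rule (N ∷ N ∷ [])
raiseR = rule (L ∷ ATM ∷ []) (Seq v2 v0 ⟨ v1 ⟩ ∷ []) (Seq v3 v0 ⟨ v1 ⟩)

-- The head of `c-seqAtom` demands a nonempty list, so membership is analysed just to exhibit `l` as
-- a cons.
elem⇒seq : {j : Tm Σ N} {l : Tm Σ L} {x : Tm Σ ATM} → Σ ⨾ Π ⟶ Elem x l → Σ ⨾ Π ⟶ Seq j l ⟨ x ⟩
elem⇒seq {j = j} {l} {x} d = elemE (at (con seq · j · l · ⟨ x ⟩)) d λ
  { f (vHere e)    → convSeq ≈refl (≈sym e) ≈refl (defI c-seqAtom (_ ∷ _ ∷ _ ∷ _ ∷ []) (convElem ≈refl e (d ↑ f)))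
  ; f (vThere e _) → convSeq ≈refl (≈sym e) ≈refl (defI c-seqAtom (_ ∷ _ ∷ _ ∷ _ ∷ []) (convElem ≈refl e (d ↑ f))) }

incl-refl : {l : Tm Σ L} → Σ ⨾ Π ⟶ ⟦ inclR ⟧ ∣ (l ∷ l ∷ [])
incl-refl = intros inclR (_ ∷ _ ∷ []) λ { f (x ∷ []) (d ∷ []) → d }

useIncl : {l l' : Tm Σ L} {x : Tm Σ ATM} → Σ ⨾ Π ⟶ ⟦ inclR ⟧ ∣ (l ∷ l' ∷ []) → Σ ⨾ Π ⟶ Elem x l → Σ ⨾ Π ⟶ Elem x l'
useIncl d e = apply inclR (_ ∷ _ ∷ []) d (_ ∷ []) (e ∷ [])

trIncl : {l l' : Tm Σ L} (f : Π ⟹ Π') → Σ ⨾ Π ⟶ ⟦ inclR ⟧ ∣ (l ∷ l' ∷ []) →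
         Σ' ⨾ Π' ⟶ ⟦ inclR ⟧ ∣ (sub (su f) l ∷ sub (su f) l' ∷ [])
trIncl = trF ⟦ inclR ⟧ (_ ∷ _ ∷ [])

incl⇒cover : {j : Tm Σ N} {l l' : Tm Σ L} → Σ ⨾ Π ⟶ ⟦ inclR ⟧ ∣ (l ∷ l' ∷ []) → Σ ⨾ Π ⟶ ⟦ coverR ⟧ ∣ (j ∷ l ∷ l' ∷ [])
incl⇒cover d = intros coverR (_ ∷ _ ∷ _ ∷ []) λ { f (x ∷ l″ ∷ []) (e ∷ d' ∷ []) →
  elem⇒seq (useIncl d' (useIncl (trIncl f d) e)) }

useCover : {j : Tm Σ N} {l l' : Tm Σ L} {x : Tm Σ ATM} →
         Σ ⨾ Π ⟶ ⟦ coverR ⟧ ∣ (j ∷ l ∷ l' ∷ []) → Σ ⨾ Π ⟶ Elem x l → Σ ⨾ Π ⟶ Seq j l' ⟨ x ⟩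
useCover r e = apply coverR (_ ∷ _ ∷ _ ∷ []) r (_ ∷ _ ∷ []) (e ∷ incl-refl ∷ [])

trCover : {j : Tm Σ N} {l l' : Tm Σ L} (f : Π ⟹ Π') → Σ ⨾ Π ⟶ ⟦ coverR ⟧ ∣ (j ∷ l ∷ l' ∷ []) →
        Σ' ⨾ Π' ⟶ ⟦ coverR ⟧ ∣ (sub (su f) j ∷ sub (su f) l ∷ sub (su f) l' ∷ [])
trCover = trF ⟦ coverR ⟧ (_ ∷ _ ∷ _ ∷ [])

-- The head is a hypothesis of any extension of `a ∷ₜ l'`; an element of the tail is covered by
-- assumption, because an extension of `a ∷ₜ l'` also extends `l'`.
cover-cons : {j : Tm Σ N} {a : Tm Σ ATM} {l l' : Tm Σ L} →
           Σ ⨾ Π ⟶ ⟦ coverR ⟧ ∣ (j ∷ l ∷ l' ∷ []) → Σ ⨾ Π ⟶ ⟦ coverR ⟧ ∣ (j ∷ a ∷ₜ l ∷ a ∷ₜ l' ∷ [])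
cover-cons {j = j} d = intros coverR (_ ∷ _ ∷ _ ∷ []) λ { f (x ∷ l″ ∷ []) (e ∷ d' ∷ []) →
  elemE (at (con seq · sub (su f) j · l″ · ⟨ x ⟩)) e λ
    { g (vHere q) → elem⇒seq (useIncl (trIncl g d')
        (convElem ≈refl (≈app (≈app ≈refl (≈sym (proj₁ (con-inj₂ q)))) ≈refl)
          (defI c-elem1 (sub (su g) x ∷ _ ∷ []) ⊤R)))
    ; g (vThere q b) → apply coverR (_ ∷ _ ∷ _ ∷ []) (trCover g (trCover f d)) (_ ∷ _ ∷ [])
        (convElem ≈refl (≈sym (proj₂ (con-inj₂ q))) b
          ∷ intros inclR (_ ∷ _ ∷ []) (λ { h (y ∷ []) (m ∷ []) →
              useIncl (trIncl h (trIncl g d')) (defI c-elem2 (_ ∷ _ ∷ _ ∷ []) m) })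
          ∷ []) } }

-- At index z an atom is provable only as a hypothesis, since backchaining requires a successor.
raise-z : {k : Tm Σ N} → Σ ⨾ Π ⟶ ⟦ raiseR ⟧ ∣ (Z ∷ k ∷ [])
raise-z {k = k} = intros raiseR (_ ∷ _ ∷ []) λ { f (l ∷ x ∷ []) (d ∷ []) →
  seqE (at (con seq · sub (su f) k · l · ⟨ x ⟩)) d λ
    { g (vAtom _ e b)  → convSeq ≈refl ≈refl (≈sym e) (elem⇒seq b)
    ; g (vTT e)        → clash e λ ()
    ; g (vAnd e _ _ _) → clash e λ ()
    ; g (vImp e _ _)   → clash e λ ()
    ; g (vAll e _ _)   → clash e λ ()
    ; g (vBack e _ _)  → clash e λ () } }

useRaise : {j k : Tm Σ N} {l : Tm Σ L} {x : Tm Σ ATM} → Σ ⨾ Π ⟶ ⟦ raiseR ⟧ ∣ (j ∷ k ∷ []) →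
           Σ ⨾ Π ⟶ Seq j l ⟨ x ⟩ → Σ ⨾ Π ⟶ Seq k l ⟨ x ⟩
useRaise up d = apply raiseR (_ ∷ _ ∷ []) up (_ ∷ _ ∷ []) (d ∷ [])

trRaise : {j k : Tm Σ N} (f : Π ⟹ Π') → Σ ⨾ Π ⟶ ⟦ raiseR ⟧ ∣ (j ∷ k ∷ []) →
          Σ' ⨾ Π' ⟶ ⟦ raiseR ⟧ ∣ (sub (su f) j ∷ sub (su f) k ∷ [])
trRaise = trF ⟦ raiseR ⟧ (_ ∷ _ ∷ [])

subst-z : {j k : Tm Σ N} → Σ ⨾ Π ⟶ ⟦ raiseR ⟧ ∣ (j ∷ k ∷ []) → Σ ⨾ Π ⟶ ⟦ substR ⟧ ∣ (j ∷ Z ∷ k ∷ [])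
subst-z {k = k} up = intros substR (_ ∷ _ ∷ _ ∷ []) λ { f (l ∷ l' ∷ b ∷ []) (r ∷ d ∷ []) →
  seqE (at (con seq · sub (su f) k · l' · b)) d λ
    { g (vAtom _ e el) → convSeq ≈refl ≈refl (≈sym e) (useRaise (trRaise g (trRaise f up)) (useCover (trCover g r) el))
    ; g (vTT e)        → convSeq ≈refl ≈refl (≈sym e) (defI c-seqTT (_ ∷ _ ∷ []) ⊤R)
    ; g (vAnd e _ _ _) → clash e λ ()
    ; g (vImp e _ _)   → clash e λ ()
    ; g (vAll e _ _)   → clash e λ ()
    ; g (vBack e _ _)  → clash e λ () } }

useSubst : {j k k' : Tm Σ N} {l l' : Tm Σ L} {b : Tm Σ PRP} → Σ ⨾ Π ⟶ ⟦ substR ⟧ ∣ (j ∷ k ∷ k' ∷ []) →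
           Σ ⨾ Π ⟶ ⟦ coverR ⟧ ∣ (j ∷ l ∷ l' ∷ []) → Σ ⨾ Π ⟶ Seq k l b → Σ ⨾ Π ⟶ Seq k' l' b
useSubst st r d = apply substR (_ ∷ _ ∷ _ ∷ []) st (_ ∷ _ ∷ _ ∷ []) (r ∷ d ∷ [])

trSubst : {j k k' : Tm Σ N} (f : Π ⟹ Π') → Σ ⨾ Π ⟶ ⟦ substR ⟧ ∣ (j ∷ k ∷ k' ∷ []) →
          Σ' ⨾ Π' ⟶ ⟦ substR ⟧ ∣ (sub (su f) j ∷ sub (su f) k ∷ sub (su f) k' ∷ [])
trSubst = trF ⟦ substR ⟧ (_ ∷ _ ∷ _ ∷ [])

-- Premises of index k go to index k' by `ih`, so the same clause rebuilds the conclusion at `S k'`;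
-- `up` serves the leaves.
subst-s : {j k k' : Tm Σ N} → Σ ⨾ Π ⟶ ⟦ substR ⟧ ∣ (j ∷ k ∷ k' ∷ []) → Σ ⨾ Π ⟶ ⟦ raiseR ⟧ ∣ (j ∷ S k' ∷ []) →
          Σ ⨾ Π ⟶ ⟦ substR ⟧ ∣ (j ∷ S k ∷ S k' ∷ [])
subst-s {k' = k'} ih up = intros substR (_ ∷ _ ∷ _ ∷ []) λ { f (l ∷ l' ∷ b ∷ []) (r ∷ d ∷ []) →
  seqE (at (con seq · S (sub (su f) k') · l' · b)) d λ
    { g (vAtom _ e el) → convSeq ≈refl ≈refl (≈sym e) (useRaise (trRaise g (trRaise f up)) (useCover (trCover g r) el))
    ; g (vTT e) → convSeq ≈refl ≈refl (≈sym e) (defI c-seqTT (_ ∷ _ ∷ []) ⊤R)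
    ; g (vAnd e₁ e d₁ d₂) → convSeq ≈refl ≈refl (≈sym e)
        (defI c-seqAnd (_ ∷ _ ∷ _ ∷ _ ∷ [])
          (∧R (useSubst (trSubst g (trSubst f ih)) (trCover g r) (convSeq (≈sym (con-inj₁ e₁)) ≈refl ≈refl d₁))
              (useSubst (trSubst g (trSubst f ih)) (trCover g r) (convSeq (≈sym (con-inj₁ e₁)) ≈refl ≈refl d₂))))
    ; g (vImp e₁ e d') → convSeq ≈refl ≈refl (≈sym e)
        (defI c-seqImp (_ ∷ _ ∷ _ ∷ _ ∷ [])
          (useSubst (trSubst g (trSubst f ih)) (cover-cons (trCover g r)) (convSeq (≈sym (con-inj₁ e₁)) ≈refl ≈refl d')))
    ; g (vAll e₁ e d') → convSeq ≈refl ≈refl (≈sym e)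
        (defI c-seqAll (_ ∷ _ ∷ _ ∷ [])
          (∀I ∀body (_ ∷ _ ∷ _ ∷ []) λ h t →
            useSubst (trSubst h (trSubst g (trSubst f ih))) (trCover h (trCover g r))
              (convSeq (sub-≈ (su h) (≈sym (con-inj₁ e₁))) ≈refl ≈refl
                (∀E ∀body (_ ∷ _ ∷ _ ∷ []) (trF (∀F I tt ∀body) (_ ∷ _ ∷ _ ∷ []) h d') t))))
    ; g (vBack {a = a} e₁ e d') → convSeq ≈refl ≈refl (≈sym e)
        (defI c-seqBack (_ ∷ _ ∷ _ ∷ [])
          (∃E ∃body (_ ∷ _ ∷ _ ∷ [])
              (∃F PRP tt ∃body ∥ (sub (su g) (sub (su f) k') ∷ sub (su g) l' ∷ a ∷ [])) d'
            λ h t p → ∃I ∃body (_ ∷ _ ∷ _ ∷ []) t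
              (∧R (∧E₁ p)
                  (useSubst (trSubst h (trSubst g (trSubst f ih))) (trCover h (trCover g r))
                    (convSeq (sub-≈ (su h) (≈sym (con-inj₁ e₁))) ≈refl ≈refl (∧E₂ p)))))) } }

raise : {k k' : Tm Σ N} {l : Tm Σ L} {b : Tm Σ PRP} →
        Σ ⨾ Π ⟶ ⟦ substR ⟧ ∣ (Z ∷ k ∷ k' ∷ []) → Σ ⨾ Π ⟶ Seq k l b → Σ ⨾ Π ⟶ Seq k' l b
raise le = useSubst le (incl⇒cover incl-refl)

subst⇒raise : {k k' : Tm Σ N} → Σ ⨾ Π ⟶ ⟦ substR ⟧ ∣ (Z ∷ k ∷ k' ∷ []) → Σ ⨾ Π ⟶ ⟦ raiseR ⟧ ∣ (k ∷ k' ∷ [])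
subst⇒raise le = intros raiseR (_ ∷ _ ∷ []) λ { f (l ∷ x ∷ []) (d ∷ []) → raise (trSubst f le) d }

-- With first index `Z`, `substR` plays the part of an order on indices; these are k ≤ k and k ≤ s
-- k.
subst-refl-suc : {k : Tm Σ N} → Σ ⨾ Π ⟶ Nat k →
                 Σ ⨾ Π ⟶ (⟦ substR ⟧ ∣ (Z ∷ k ∷ k ∷ []) ∧F ⟦ substR ⟧ ∣ (Z ∷ k ∷ S k ∷ []))
subst-refl-suc = natI (⟦ substR ⟧ ∣ (Z ∷ v0 ∷ v0 ∷ []) ∧F ⟦ substR ⟧ ∣ (Z ∷ v0 ∷ S v0 ∷ []))
  (∧R (subst-z raise-z) (subst-z raise-z))
  (λ ih → ∧R (subst-s (∧E₁ ih) raise-z) (subst-s (∧E₂ ih) raise-z))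

subst-trans : {j k k' k″ : Tm Σ N} → Σ ⨾ Π ⟶ ⟦ substR ⟧ ∣ (j ∷ k ∷ k' ∷ []) →
              Σ ⨾ Π ⟶ ⟦ substR ⟧ ∣ (Z ∷ k' ∷ k″ ∷ []) → Σ ⨾ Π ⟶ ⟦ substR ⟧ ∣ (j ∷ k ∷ k″ ∷ [])
subst-trans s' le = intros substR (_ ∷ _ ∷ _ ∷ []) λ { f (l ∷ l' ∷ b ∷ []) (r ∷ d ∷ []) →
  raise (trSubst f le) (useSubst (trSubst f s') r d) }

-- In (k', j, k): the middle conjunct is j ≤ k', carried along because `subst-s` must raise leaves
-- from j. The witness built below is j at k = z and grows by one at each step, in effect j + k.
boundF : Form (N ∷ N ∷ N ∷ [])
boundF = Nat v0 ∧F ⟦ substR ⟧ ∣ (Z ∷ v1 ∷ v0 ∷ []) ∧F ⟦ substR ⟧ ∣ (v1 ∷ v2 ∷ v0 ∷ [])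

boundR : Rule (N ∷ [])
boundR = rule (N ∷ []) (Nat v0 ∷ []) (∃F N tt boundF)

-- The new index must not depend on the context and the formula, because the clause for ⋀ has a
-- premise ∀x seq_k L (B x) in which k is chosen before x.
subst-bound : {k : Tm Σ N} → Σ ⨾ Π ⟶ Nat k → Σ ⨾ Π ⟶ ⟦ boundR ⟧ ∣ (k ∷ [])
subst-bound = natI ⟦ boundR ⟧
  (intros boundR (Z ∷ []) λ { f (j ∷ []) (n ∷ []) →
    ∃I boundF (j ∷ Z ∷ []) j (∧R n (∧R (∧E₁ (subst-refl-suc n)) (subst-z (subst⇒raise (∧E₁ (subst-refl-suc n)))))) })
  (λ {_ _ k} ih → intros boundR (S k ∷ []) λ { f (j ∷ []) (n ∷ []) →
    ∃E boundF (j ∷ sub (su f) k ∷ []) (∃F N tt boundF ∥ (j ∷ S (sub (su f) k) ∷ []))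
      (apply boundR (_ ∷ []) (trF ⟦ boundR ⟧ (_ ∷ []) f ih) (_ ∷ []) (n ∷ []))
      λ g k' p →
        let n' = ∧E₁ p
            le = subst-trans (∧E₁ (∧E₂ p)) (∧E₂ (subst-refl-suc n')) in
        ∃I boundF (_ ∷ S _ ∷ []) (S k') (∧R (natS n') (∧R le (subst-s (∧E₂ (∧E₂ p)) (subst⇒raise le)))) })

boundE : (g : Goal Σ) {j k : Tm Σ N} → Σ ⨾ Π ⟶ Nat j → Σ ⨾ Π ⟶ Nat k →
         (∀ {Σ'} {Π' : List (Form Σ')} (f : Π ⟹ Π') (k' : Tm Σ' N) → Σ' ⨾ Π' ⟶ Nat k' →
          Σ' ⨾ Π' ⟶ ⟦ substR ⟧ ∣ (Z ∷ sub (su f) j ∷ k' ∷ []) →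
          Σ' ⨾ Π' ⟶ ⟦ substR ⟧ ∣ (sub (su f) j ∷ sub (su f) k ∷ k' ∷ []) →
          Σ' ⨾ Π' ⟶ ⌊ mapG (su f) g ⌋) →
         Σ ⨾ Π ⟶ ⌊ g ⌋
boundE g {j} {k} n m h =
  ∃E boundF (j ∷ k ∷ []) g (apply boundR (k ∷ []) (subst-bound m) (j ∷ []) (n ∷ [])) λ f k' p →
    h f k' (∧E₁ p) (∧E₁ (∧E₂ p)) (∧E₂ (∧E₂ p))

predR : Rule (N ∷ [])
predR = rule (N ∷ []) (atom (con eqN · v1 · S v0) ∷ []) (Nat v0)

-- `nat` is not a defined predicate, so it cannot be inverted by `defL`. Induction proves `nat`
-- together with its inversion; the latter speaks of `eqN`, the formula standing in for `≈`.
natPred : {k k' : Tm Σ N} → k ≈ S k' → Σ ⨾ Π ⟶ Nat k → Σ ⨾ Π ⟶ Nat k'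
natPred {k = k} {k'} e n = apply predR (k ∷ [])
  (∧E₂ (natI (Nat v0 ∧F ⟦ predR ⟧)
    (∧R natZ (intros predR (Z ∷ []) λ { f (j ∷ []) (d ∷ []) →
      eqNE (at (con nat · j)) d λ g e' → clash e' λ () }))
    (λ {_ _ t} ih → ∧R (natS (∧E₁ ih)) (intros predR (S t ∷ []) λ { f (j ∷ []) (d ∷ []) →
      eqNE (at (con nat · j)) d λ g e' → convNat (con-inj₁ e') (∧E₁ ih ↑ f ↑ g) }))
    n))
  (k' ∷ []) (convR (atom≈ (≈app (≈app ≈refl (≈sym e)) ≈refl)) (defI c-eq (S k' ∷ []) ⊤R) ∷ [])

-- Provability in the object logic

⊢body : Form (N ∷ PRP ∷ [])
⊢body = Nat v0 ∧F Seq v0 NIL v1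

prv : Tm Σ PRP → Goal Σ
prv b = ∃F N tt ⊢body ∥ (b ∷ [])

⊢I : {k : Tm Σ N} {b : Tm Σ PRP} → Σ ⨾ Π ⟶ Nat k → Σ ⨾ Π ⟶ Seq k NIL b → Σ ⨾ Π ⟶ ⊢ b
⊢I {k = k} n d = ∃I ⊢body (_ ∷ []) k (∧R n d)

⊢E : (g : Goal Σ) (b : Tm Σ PRP) → Σ ⨾ Π ⟶ ⊢ b →
     (∀ {Σ'} {Π' : List (Form Σ')} (f : Π ⟹ Π') (k : Tm Σ' N) → Σ' ⨾ Π' ⟶ Nat k →
      Σ' ⨾ Π' ⟶ Seq k NIL (sub (su f) b) → Σ' ⨾ Π' ⟶ ⌊ mapG (su f) g ⌋) →
     Σ ⨾ Π ⟶ ⌊ g ⌋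
⊢E g b d h = ∃E ⊢body (b ∷ []) g d λ f k p → h f k (∧E₁ p) (∧E₂ p)

⊢conv : {b c : Tm Σ PRP} → b ≈ c → Σ ⨾ Π ⟶ ⊢ b → Σ ⨾ Π ⟶ ⊢ c
⊢conv = conv₁ (∃F N tt ⊢body)

⊢tr : {b : Tm Σ PRP} (f : Π ⟹ Π') → Σ ⨾ Π ⟶ ⊢ b → Σ' ⨾ Π' ⟶ ⊢ sub (su f) b
⊢tr f d = trF (∃F N tt ⊢body) (_ ∷ []) f d

⊢tt : Σ ⨾ Π ⟶ ⊢ con ttP
⊢tt = ⊢I natZ (defI c-seqTT (_ ∷ _ ∷ []) ⊤R)

⊢& : (b c : Tm Σ PRP) → Σ ⨾ Π ⟶ ⊢ b → Σ ⨾ Π ⟶ ⊢ c → Σ ⨾ Π ⟶ ⊢ (b & c)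
⊢& b c d e = ⊢E (prv (b & c)) b d λ f k n d' → ⊢E (prv (sub (su f) (b & c))) (sub (su f) c) (⊢tr {b = c} f e) λ g j m e' →
  boundE (prv (sub (su g) (sub (su f) (b & c)))) (n ↑ g) m λ h i' n' le s' →
    ⊢I (natS n') (defI c-seqAnd (_ ∷ _ ∷ _ ∷ _ ∷ [])
      (∧R (raise le (d' ↑ g ↑ h)) (useSubst s' (incl⇒cover incl-refl) (e' ↑ h))))

⊢back : (a : Tm Σ ATM) (b : Tm Σ PRP) → Σ ⨾ Π ⟶ Prog a b → Σ ⨾ Π ⟶ ⊢ b → Σ ⨾ Π ⟶ ⊢ ⟨ a ⟩
⊢back a b p d = ⊢E (prv ⟨ a ⟩) b d λ f k n d' →
  ⊢I (natS n) (defI c-seqBack (_ ∷ _ ∷ _ ∷ [])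
    (∃I ∃body (_ ∷ _ ∷ _ ∷ []) _ (∧R (p ↑ f) d')))

elem-NIL : (g : Goal Σ) {x : Tm Σ ATM} → Σ ⨾ Π ⟶ Elem x NIL → Σ ⨾ Π ⟶ ⌊ g ⌋
elem-NIL g d = elemE g d λ { f (vHere e) → clash e λ () ; f (vThere e _) → clash e λ () }

incl-NIL : {l : Tm Σ L} → Σ ⨾ Π ⟶ ⟦ inclR ⟧ ∣ (NIL ∷ l ∷ [])
incl-NIL = intros inclR (_ ∷ _ ∷ []) λ { f (x ∷ []) (d ∷ []) → elem-NIL (at _) d }

⊢cut : {k : Tm Σ N} (a : Tm Σ ATM) (b : Tm Σ PRP) → Σ ⨾ Π ⟶ Nat k → Σ ⨾ Π ⟶ Seq k (a ∷ₜ NIL) b →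
       Σ ⨾ Π ⟶ ⊢ ⟨ a ⟩ → Σ ⨾ Π ⟶ ⊢ b
⊢cut a b n d e = ⊢E (prv b) ⟨ a ⟩ e λ f j m e' →
  boundE (prv (sub (su f) b)) m (n ↑ f) λ g k' n' _ st →
    ⊢I n' (useSubst st
      -- `NIL` covers the one-element list: the proof of the cut atom is weakened from `NIL` to any
      -- `l`, keeping its index.
      (intros coverR (_ ∷ _ ∷ _ ∷ []) λ { h (x ∷ l ∷ []) (el ∷ _ ∷ []) →
        elemE (at (con seq · sub (su h) (sub (su g) j) · l · ⟨ x ⟩)) el λ
          { h' (vHere q) → convSeq ≈refl ≈refl (≈app ≈refl (proj₁ (con-inj₂ q)))
              (useSubst (∧E₁ (subst-refl-suc (m ↑ g ↑ h ↑ h'))) (incl⇒cover incl-NIL) (e' ↑ g ↑ h ↑ h'))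
          ; h' (vThere q el') → elem-NIL (at _) (convElem ≈refl (≈sym (proj₂ (con-inj₂ q))) el') } })
      (d ↑ f ↑ g))

-- Nested eliminations apply their substitutions one after the other, while a continuation expects
-- the composite; on an abstract goal the two agree only propositionally.
mapG-⨟ : ∀ {Σ₁ Σ₂ Σ₃} {Π₁ : List (Form Σ₁)} {Π₂ : List (Form Σ₂)} {Π₃ : List (Form Σ₃)}
         (f : Π₁ ⟹ Π₂) (f' : Π₂ ⟹ Π₃) (g : Goal Σ₁) →
         Σ₃ ⨾ Π₃ ⟶ ⌊ mapG (su (f ⨟ f')) g ⌋ → Σ₃ ⨾ Π₃ ⟶ ⌊ mapG (su f') (mapG (su f) g) ⌋
mapG-⨟ f f' (F ∥ ρ) = substD refl (cong (F ∣_) (sym (mapₑ-mapₑ (su f) (su f') ρ)))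

≈-⨟ : ∀ {Σ₁ Σ₂ Σ₃} {Π₁ : List (Form Σ₁)} {Π₂ : List (Form Σ₂)} {Π₃ : List (Form Σ₃)}
      (f : Π₁ ⟹ Π₂) (f' : Π₂ ⟹ Π₃) (t : Tm Σ₁ A) → sub (su (f ⨟ f')) t ≈ sub (su f') (sub (su f) t)
≈-⨟ f f' t = ≡⇒≈ (sym (sub-sub (λ _ → refl) t))

-- Without hypotheses, an atom can only be proved by backchaining.
backE : (g : Goal Σ) {k : Tm Σ N} (a : Tm Σ ATM) → Σ ⨾ Π ⟶ Seq k NIL ⟨ a ⟩ →
        (∀ {Σ'} {Π' : List (Form Σ')} (f : Π ⟹ Π') {k' : Tm Σ' N} {b} → sub (su f) k ≈ S k' →
         ProgView (sub (su f) a) b → Σ' ⨾ Π' ⟶ Seq k' NIL b → Σ' ⨾ Π' ⟶ ⌊ mapG (su f) g ⌋) →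
        Σ ⨾ Π ⟶ ⌊ g ⌋
backE g {k} a d h = seqE g d λ
  { f (vAtom e _ _)  → clash e λ ()
  ; f (vTT e)        → clash e λ ()
  ; f (vAnd _ e _ _) → clash e λ ()
  ; f (vImp _ e _)   → clash e λ ()
  ; f (vAll _ e _)   → clash e λ ()
  ; f (vBack e₁ e₂ d') →
      ∃E ∃body (_ ∷ _ ∷ _ ∷ []) (mapG (su f) g) d' λ f₁ b p → mapG-⨟ f f₁ g
        (progE (mapG (su (f ⨟ f₁)) g)
          (convR (atom≈ (≈app (≈app ≈refl (≈sym (≈trans (≈-⨟ f f₁ a) (sub-≈ (su f₁) (con-inj₁ e₂))))) ≈refl)) (∧E₁ p))
          λ f₂ v → mapG-⨟ (f ⨟ f₁) f₂ g
            (h (f ⨟ f₁ ⨟ f₂)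
               (≈trans (≈-⨟ (f ⨟ f₁) f₂ k) (sub-≈ (su f₂) (≈trans (≈-⨟ f f₁ k) (sub-≈ (su f₁) e₁))))
               (subst (λ a' → ProgView a' _) (sub-sub (λ _ → refl) a) v)
               (∧E₂ p ↑ f₂))) }

&E : (g : Goal Σ) {k : Tm Σ N} {b c : Tm Σ PRP} → Σ ⨾ Π ⟶ Seq k NIL (b & c) →
     (∀ {Σ'} {Π' : List (Form Σ')} (f : Π ⟹ Π') {k' : Tm Σ' N} → sub (su f) k ≈ S k' →
      Σ' ⨾ Π' ⟶ Seq k' NIL (sub (su f) b) → Σ' ⨾ Π' ⟶ Seq k' NIL (sub (su f) c) →
      Σ' ⨾ Π' ⟶ ⌊ mapG (su f) g ⌋) →
     Σ ⨾ Π ⟶ ⌊ g ⌋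
&E g d h = seqE g d λ
  { f (vAtom e _ _)     → clash e λ ()
  ; f (vTT e)           → clash e λ ()
  ; f (vAnd e₁ e d₁ d₂) → h f e₁ (convSeq ≈refl ≈refl (≈sym (proj₁ (con-inj₂ e))) d₁)
                                 (convSeq ≈refl ≈refl (≈sym (proj₂ (con-inj₂ e))) d₂)
  ; f (vImp _ e _)      → clash e λ ()
  ; f (vAll _ e _)      → clash e λ ()
  ; f (vBack _ e _)     → clash e λ () }

-- Inversion and introduction for the object predicates

infix 10 _⇓_ _↝_ _↝*_ _∶_
abs : Tm Σ (I ⇒ I) → Tm Σ I
abs r = con absC · r
app : Tm Σ I → Tm Σ I → Tm Σ I
app m n = con appC · m · n
_⇓_ _↝_ _↝*_ _∶_ : Tm Σ I → Tm Σ I → Tm Σ PRP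
m ⇓ n  = ⟨ con evalC · m · n ⟩
m ↝ n  = ⟨ con stepC · m · n ⟩
m ↝* n = ⟨ con stepsC · m · n ⟩
m ∶ t  = ⟨ con typeof · m · t ⟩

≈con₂ : {c : Const (A ⇒ B ⇒ C)} {t t' : Tm Σ A} {u u' : Tm Σ B} →
        t ≈ t' → u ≈ u' → con c · t · u ≈ con c · t' · u'
≈con₂ e f = ≈app (≈app ≈refl e) f

≈⟨⟩ : {c : Const (A ⇒ B ⇒ ATM)} {t t' : Tm Σ A} {u u' : Tm Σ B} →
      t ≈ t' → u ≈ u' → ⟨ con c · t · u ⟩ ≈ ⟨ con c · t' · u' ⟩
≈⟨⟩ e f = ≈app ≈refl (≈con₂ e f)

module _ {Σ : Ctx} (Π : List (Form Σ)) where

  data EvalView (k : Tm Σ N) (m v : Tm Σ I) : Set where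
    evAbs : ∀ {r} → m ≈ abs r → v ≈ abs r → EvalView k m v
    evApp : ∀ {k' p n r} → k ≈ S (S k') → m ≈ app p n →
            Σ ⨾ Π ⟶ Seq k' NIL (p ⇓ abs r) → Σ ⨾ Π ⟶ Seq k' NIL ((r · n) ⇓ v) → EvalView k m v

  data StepView (k : Tm Σ N) (m n : Tm Σ I) : Set where
    stBeta : ∀ {r p} → m ≈ app (abs r) p → n ≈ r · p → StepView k m n
    stApp  : ∀ {k' p q p'} → k ≈ S k' → m ≈ app p q → n ≈ app p' q → Σ ⨾ Π ⟶ Seq k' NIL (p ↝ p') → StepView k m n

  data StepsView (k : Tm Σ N) (m n : Tm Σ I) : Set where
    stsRefl : m ≈ n → StepsView k m n
    stsStep : ∀ {k' p} → k ≈ S (S k') → Σ ⨾ Π ⟶ Seq k' NIL (m ↝ p) → Σ ⨾ Π ⟶ Seq k' NIL (p ↝* n) → StepsView k m n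

evalE : (g : Goal Σ) {k : Tm Σ N} {m v : Tm Σ I} → Σ ⨾ Π ⟶ Seq k NIL (m ⇓ v) →
        (∀ {Σ'} {Π' : List (Form Σ')} (f : Π ⟹ Π') → EvalView Π' (sub (su f) k) (sub (su f) m) (sub (su f) v) →
         Σ' ⨾ Π' ⟶ ⌊ mapG (su f) g ⌋) →
        Σ ⨾ Π ⟶ ⌊ g ⌋
evalE g {k} {m} {v} d h = backE g _ d λ
  { f e (vTyAbs q _) d' → clash q λ ()
  ; f e (vTyApp q _) d' → clash q λ ()
  ; f e (vEvAbs q) d' → h f (evAbs (proj₁ (con-inj₂ q)) (proj₂ (con-inj₂ q)))
  ; f e (vEvApp q q') d' → &E (mapG (su f) g) (convSeq ≈refl ≈refl q' d') λ f₁ e' d₁ d₂ → mapG-⨟ f f₁ g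
      (h (f ⨟ f₁) (evApp (≈trans (≈-⨟ f f₁ k) (≈trans (sub-≈ (su f₁) e) (≈app ≈refl e')))
                         (≈trans (≈-⨟ f f₁ m) (sub-≈ (su f₁) (proj₁ (con-inj₂ q)))) d₁
                         (convSeq ≈refl ≈refl (≈⟨⟩ ≈refl (≈sym (≈trans (≈-⨟ f f₁ v) (sub-≈ (su f₁) (proj₂ (con-inj₂ q)))))) d₂)))
  ; f e (vStBeta q) d' → clash q λ ()
  ; f e (vStApp q _) d' → clash q λ ()
  ; f e (vStsRefl q) d' → clash q λ ()
  ; f e (vStsStep q _) d' → clash q λ () }

stepE : (g : Goal Σ) {k : Tm Σ N} {m n : Tm Σ I} → Σ ⨾ Π ⟶ Seq k NIL (m ↝ n) →
        (∀ {Σ'} {Π' : List (Form Σ')} (f : Π ⟹ Π') → StepView Π' (sub (su f) k) (sub (su f) m) (sub (su f) n) →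
         Σ' ⨾ Π' ⟶ ⌊ mapG (su f) g ⌋) →
        Σ ⨾ Π ⟶ ⌊ g ⌋
stepE g d h = backE g _ d λ
  { f e (vTyAbs q _) d' → clash q λ ()
  ; f e (vTyApp q _) d' → clash q λ ()
  ; f e (vEvAbs q) d' → clash q λ ()
  ; f e (vEvApp q _) d' → clash q λ ()
  ; f e (vStBeta q) d' → h f (stBeta (proj₁ (con-inj₂ q)) (proj₂ (con-inj₂ q)))
  ; f e (vStApp q q') d' → h f (stApp e (proj₁ (con-inj₂ q)) (proj₂ (con-inj₂ q)) (convSeq ≈refl ≈refl q' d'))
  ; f e (vStsRefl q) d' → clash q λ ()
  ; f e (vStsStep q _) d' → clash q λ () }

stepsE : (g : Goal Σ) {k : Tm Σ N} {m n : Tm Σ I} → Σ ⨾ Π ⟶ Seq k NIL (m ↝* n) →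
         (∀ {Σ'} {Π' : List (Form Σ')} (f : Π ⟹ Π') → StepsView Π' (sub (su f) k) (sub (su f) m) (sub (su f) n) →
          Σ' ⨾ Π' ⟶ ⌊ mapG (su f) g ⌋) →
         Σ ⨾ Π ⟶ ⌊ g ⌋
stepsE g {k} {m} {n} d h = backE g _ d λ
  { f e (vTyAbs q _) d' → clash q λ ()
  ; f e (vTyApp q _) d' → clash q λ ()
  ; f e (vEvAbs q) d' → clash q λ ()
  ; f e (vEvApp q _) d' → clash q λ ()
  ; f e (vStBeta q) d' → clash q λ ()
  ; f e (vStApp q _) d' → clash q λ ()
  ; f e (vStsRefl q) d' → h f (stsRefl (≈trans (proj₁ (con-inj₂ q)) (≈sym (proj₂ (con-inj₂ q)))))
  ; f e (vStsStep q q') d' → &E (mapG (su f) g) (convSeq ≈refl ≈refl q' d') λ f₁ e' d₁ d₂ → mapG-⨟ f f₁ g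
      (h (f ⨟ f₁) (stsStep
        (≈trans (≈-⨟ f f₁ k) (≈trans (sub-≈ (su f₁) e) (≈app ≈refl e')))
        (convSeq ≈refl ≈refl (≈⟨⟩ (≈sym (≈trans (≈-⨟ f f₁ m) (sub-≈ (su f₁) (proj₁ (con-inj₂ q))))) ≈refl) d₁)
        (convSeq ≈refl ≈refl (≈⟨⟩ ≈refl (≈sym (≈trans (≈-⨟ f f₁ n) (sub-≈ (su f₁) (proj₂ (con-inj₂ q)))))) d₂))) }

-- Both clauses for `↝` have an application on the left. This separates the two overlapping step
-- clauses and makes abstractions normal for `↝*`.
abs-↝ : (g : Goal Σ) {k : Tm Σ N} {m n : Tm Σ I} {r : Tm Σ (I ⇒ I)} → m ≈ abs r →
        Σ ⨾ Π ⟶ Seq k NIL (m ↝ n) → Σ ⨾ Π ⟶ ⌊ g ⌋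
abs-↝ g e d = stepE g d λ
  { f (stBeta q _)    → clash (≈trans (≈sym (sub-≈ (su f) e)) q) λ ()
  ; f (stApp _ q _ _) → clash (≈trans (≈sym (sub-≈ (su f) e)) q) λ () }

-- Subject reduction inducts on the reduction, never on the typing, so the typings are returned as
-- `⊢`, with `natPred` restoring the `nat` proof of the smaller index.
∶appE : (g : Goal Σ) {m n t : Tm Σ I} → Σ ⨾ Π ⟶ ⊢ (app m n ∶ t) →
        (∀ {Σ'} {Π' : List (Form Σ')} (f : Π ⟹ Π') {u : Tm Σ' I} →
         Σ' ⨾ Π' ⟶ ⊢ (sub (su f) m ∶ (con arr · u · sub (su f) t)) → Σ' ⨾ Π' ⟶ ⊢ (sub (su f) n ∶ u) →
         Σ' ⨾ Π' ⟶ ⌊ mapG (su f) g ⌋) →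
        Σ ⨾ Π ⟶ ⌊ g ⌋
∶appE g {m} {n} {t} d h = ⊢E g (app m n ∶ t) d λ f₀ k nk d₀ → backE (mapG (su f₀) g) _ d₀ λ
  { f e (vTyAbs q _) d' → clash (proj₁ (con-inj₂ q)) λ ()
  ; f e (vTyApp q q') d' → mapG-⨟ f₀ f g
      (&E (mapG (su (f₀ ⨟ f)) g) (convSeq ≈refl ≈refl q' d') λ f₁ e' d₁ d₂ → mapG-⨟ (f₀ ⨟ f) f₁ g
        (let up : ∀ x {x'} → sub (su f) (sub (su f₀) x) ≈ x' → sub (su (f₀ ⨟ f ⨟ f₁)) x ≈ sub (su f₁) x'
             up = λ x e → ≈trans (≈-⨟ (f₀ ⨟ f) f₁ x) (sub-≈ (su f₁) (≈trans (≈-⨟ f₀ f x) e))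
             em , en = con-inj₂ (proj₁ (con-inj₂ q))
             nk' = natPred e' (natPred (sub-≈ (su f₁) e) (nk ↑ f ↑ f₁)) in
         h (f₀ ⨟ f ⨟ f₁)
           (⊢I nk' (convSeq ≈refl ≈refl (≈⟨⟩ (≈sym (up m em)) (≈con₂ ≈refl (≈sym (up t (proj₂ (con-inj₂ q)))))) d₁))
           (⊢I nk' (convSeq ≈refl ≈refl (≈⟨⟩ (≈sym (up n en)) ≈refl) d₂))))
  ; f e (vEvAbs q) d' → clash q λ ()
  ; f e (vEvApp q _) d' → clash q λ ()
  ; f e (vStBeta q) d' → clash q λ ()
  ; f e (vStApp q _) d' → clash q λ ()
  ; f e (vStsRefl q) d' → clash q λ ()
  ; f e (vStsStep q _) d' → clash q λ () }

∶absBody : Tm Σ (I ⇒ I) → Tm Σ I → Tm Σ I → Tm Σ PRP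
∶absBody r t u = con allP · lam (con impP · (con typeof · v0 · ren there t) · (ren there r · v0) ∶ ren there u)

-- The object quantifier is instantiated at `n` itself, so substitution for the bound term variable
-- comes for free; only the typing hypothesis about `n` remains.
∶absBodyE : (g : Goal Σ) {k : Tm Σ N} {r : Tm Σ (I ⇒ I)} {t u : Tm Σ I} (n : Tm Σ I) →
            Σ ⨾ Π ⟶ Seq k NIL (∶absBody r t u) →
            (∀ {Σ'} {Π' : List (Form Σ')} (f : Π ⟹ Π') {k'} → sub (su f) k ≈ S (S k') →
             Σ' ⨾ Π' ⟶ Seq k' ((con typeof · sub (su f) n · sub (su f) t) ∷ₜ NIL)
                              ((sub (su f) r · sub (su f) n) ∶ sub (su f) u) →
             Σ' ⨾ Π' ⟶ ⌊ mapG (su f) g ⌋) →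
            Σ ⨾ Π ⟶ ⌊ g ⌋
∶absBodyE {Π = Π} g {k} {r} {t} {u} n d h = seqE g d λ
  { f (vAtom e _ _)  → clash e λ ()
  ; f (vTT e)        → clash e λ ()
  ; f (vAnd _ e _ _) → clash e λ ()
  ; f (vImp _ e _)   → clash e λ ()
  ; f (vAll e q d')  →
      seqE (mapG (su f) g) (convSeq ≈refl ≈refl
             (≈trans (≈app (≈sym (con-inj₁ q)) ≈refl)
               (≈trans β (≈con₂ (≈con₂ ≈refl (≡⇒≈ (inst f t))) (≈⟨⟩ (≈app (≡⇒≈ (inst f r)) ≈refl) (≡⇒≈ (inst f u))))))
             (∀E ∀body (_ ∷ _ ∷ _ ∷ []) d' (sub (su f) n))) λ
        { f₁ (vAtom e _ _)   → clash e λ ()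
        ; f₁ (vTT e)         → clash e λ ()
        ; f₁ (vAnd _ e _ _)  → clash e λ ()
        ; f₁ (vImp e' q' d₁) → mapG-⨟ f f₁ g
            (h (f ⨟ f₁) (≈trans (≈-⨟ f f₁ k) (≈trans (sub-≈ (su f₁) e) (≈app ≈refl e')))
               (convSeq ≈refl
                 (≈con₂ (≈trans (≈sym (proj₁ (con-inj₂ q'))) (≈con₂ (≈sym (≈-⨟ f f₁ n)) (≈sym (≈-⨟ f f₁ t)))) ≈refl)
                 (≈trans (≈sym (proj₂ (con-inj₂ q')))
                         (≈⟨⟩ (≈app (≈sym (≈-⨟ f f₁ r)) (≈sym (≈-⨟ f f₁ n))) (≈sym (≈-⨟ f f₁ u)))) d₁))
        ; f₁ (vAll _ e _)    → clash e λ ()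
        ; f₁ (vBack _ e _)   → clash e λ () }
  ; f (vBack _ e _)  → clash e λ () }
  where
  inst : ∀ {A Σ'} {Π' : List (Form Σ')} (f : Π ⟹ Π') (x : Tm _ A) →
         sub (sub0 (sub (su f) n)) (sub (exts (su f)) (ren there x)) ≡ sub (su f) x
  inst f x = trans (cong (sub (sub0 _)) (sub-exts-wk (su f) x)) (sub-sub0-wk _ (sub (su f) x))

-- The cut rule of the object logic plays the role of the substitution lemma for typing.
∶β : {r : Tm Σ (I ⇒ I)} {n t u : Tm Σ I} → Σ ⨾ Π ⟶ ⊢ (abs r ∶ (con arr · u · t)) → Σ ⨾ Π ⟶ ⊢ (n ∶ u) →
     Σ ⨾ Π ⟶ ⊢ ((r · n) ∶ t)
∶β {r = r} {n} {t} {u} d e = ⊢E (prv ((r · n) ∶ t)) (abs r ∶ (con arr · u · t)) d λ f₀ k nk d₀ →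
  backE (prv ((sub (su f₀) r · sub (su f₀) n) ∶ sub (su f₀) t)) _ d₀ λ
    { f q₁ (vTyAbs q q') d' →
        let er = con-inj₁ (proj₁ (con-inj₂ q))
            eu , et = con-inj₂ (proj₂ (con-inj₂ q)) in
        ∶absBodyE (prv (sub (su f) (sub (su f₀) ((r · n) ∶ t)))) (sub (su f) (sub (su f₀) n)) (convSeq ≈refl ≈refl q' d')
          λ f₁ q₂ d₁ →
            ⊢conv (≈⟨⟩ (≈app (sub-≈ (su f₁) (≈sym er)) ≈refl) (sub-≈ (su f₁) (≈sym et)))
              -- Three predecessors: one for backchaining, one for the quantifier, one for the
              -- implication.
              (⊢cut _ _ (natPred ≈refl (natPred q₂ (natPred (sub-≈ (su f₁) q₁) (nk ↑ f ↑ f₁)))) d₁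
                (⊢conv (≈⟨⟩ ≈refl (sub-≈ (su f₁) eu)) (⊢tr {b = sub (su f) (sub (su f₀) (n ∶ u))} f₁ (⊢tr {b = sub (su f₀) (n ∶ u)} f (⊢tr {b = n ∶ u} f₀ e)))))
    ; f _ (vTyApp q _) d' → clash (proj₁ (con-inj₂ q)) λ ()
    ; f _ (vEvAbs q) d' → clash q λ ()
    ; f _ (vEvApp q _) d' → clash q λ ()
    ; f _ (vStBeta q) d' → clash q λ ()
    ; f _ (vStApp q _) d' → clash q λ ()
    ; f _ (vStsRefl q) d' → clash q λ ()
    ; f _ (vStsStep q _) d' → clash q λ () }

⊢evAbs : {r : Tm Σ (I ⇒ I)} → Σ ⨾ Π ⟶ ⊢ (abs r ⇓ abs r)
⊢evAbs = ⊢back _ _ (defI c-evAbs (_ ∷ []) ⊤R) ⊢tt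

⊢evApp : {m n v : Tm Σ I} {r : Tm Σ (I ⇒ I)} → Σ ⨾ Π ⟶ ⊢ (m ⇓ abs r) → Σ ⨾ Π ⟶ ⊢ ((r · n) ⇓ v) →
         Σ ⨾ Π ⟶ ⊢ (app m n ⇓ v)
⊢evApp {m = m} {n} {v} {r} d e = ⊢back _ _ (defI c-evApp (m ∷ n ∷ v ∷ r ∷ []) ⊤R) (⊢& _ _ d e)

⊢stBeta : {r : Tm Σ (I ⇒ I)} {n : Tm Σ I} → Σ ⨾ Π ⟶ ⊢ (app (abs r) n ↝ (r · n))
⊢stBeta = ⊢back _ _ (defI c-stBeta (_ ∷ _ ∷ []) ⊤R) ⊢tt

⊢stApp : {m n m' : Tm Σ I} → Σ ⨾ Π ⟶ ⊢ (m ↝ m') → Σ ⨾ Π ⟶ ⊢ (app m n ↝ app m' n)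
⊢stApp {m = m} {n} {m'} d = ⊢back _ _ (defI c-stApp (m ∷ n ∷ m' ∷ []) ⊤R) d

⊢stsRefl : {m : Tm Σ I} → Σ ⨾ Π ⟶ ⊢ (m ↝* m)
⊢stsRefl = ⊢back _ _ (defI c-stsRefl (_ ∷ []) ⊤R) ⊢tt

⊢stsStep : {m n m' : Tm Σ I} → Σ ⨾ Π ⟶ ⊢ (m ↝ m') → Σ ⨾ Π ⟶ ⊢ (m' ↝* n) → Σ ⨾ Π ⟶ ⊢ (m ↝* n)
⊢stsStep {m = m} {n} {m'} d e = ⊢back _ _ (defI c-stsStep (m ∷ n ∷ m' ∷ []) ⊤R) (⊢& _ _ d e)

⊢tyApp : {m n t u : Tm Σ I} → Σ ⨾ Π ⟶ ⊢ (m ∶ (con arr · u · t)) → Σ ⨾ Π ⟶ ⊢ (n ∶ u) → Σ ⨾ Π ⟶ ⊢ (app m n ∶ t)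
⊢tyApp {m = m} {n} {t} {u} d e = ⊢back _ _ (defI c-tyApp (m ∷ n ∷ t ∷ u ∷ []) ⊤R) (⊢& _ _ d e)

eqvI : {m n : Tm Σ I} → m ≈ n → Σ ⨾ Π ⟶ atom (con eqv · m · n)
eqvI e = convR (atom≈ (≈con₂ ≈refl e)) (defI c-equiv (_ ∷ []) ⊤R)

eqvG : Tm Σ I → Tm Σ I → Goal Σ
eqvG m n = at (con eqv · m · n)

-- Determinacy

-- The induction is on the first derivation. The index of the second is quantified inside, because
-- inversion changes it too.
detEvalR : Rule (N ∷ [])
detEvalR = rule (I ∷ I ∷ I ∷ N ∷ []) (Seq v4 NIL (v0 ⇓ v1) ∷ Seq v3 NIL (v0 ⇓ v2) ∷ []) (atom (con eqv · v1 · v2))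

detEval : {k : Tm Σ N} → Σ ⨾ Π ⟶ Nat k → Σ ⨾ Π ⟶ ⟦ detEvalR ⟧ ∣ (k ∷ [])
detEval = natI₂ ⟦ detEvalR ⟧ λ t ih → intros detEvalR (t ∷ []) λ { f (m ∷ m₁ ∷ m₂ ∷ j ∷ []) (d₁ ∷ d₂ ∷ []) →
  evalE (eqvG m₁ m₂) d₁ λ
    { g (evAbs e₁ e₂) → evalE (eqvG (sub (su g) m₁) (sub (su g) m₂)) (d₂ ↑ g) λ
        { h (evAbs e₁' e₂') →
            eqvI (≈trans (sub-≈ (su h) e₂) (≈trans (≈sym (sub-≈ (su h) e₁)) (≈trans e₁' (≈sym e₂'))))
        ; h (evApp _ e' _ _) → clash (≈trans (sub-≈ (su h) (≈sym e₁)) e') λ () }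
    ; g (evApp ek e a b) → evalE (eqvG (sub (su g) m₁) (sub (su g) m₂)) (d₂ ↑ g) λ
        { h (evAbs e' _) → clash (≈trans (sub-≈ (su h) (≈sym e)) e') λ ()
        ; h (evApp _ e' a' b') →
            let ih' = trF ⟦ detEvalR ⟧ (_ ∷ []) h (ih (f ⨟ g) (two (≈trans (≈-⨟ f g t) ek)))
                ep , en = con-inj₂ (≈trans (sub-≈ (su h) (≈sym e)) e') in
            -- The first induction hypothesis equates the abstractions reached by the function part.
            -- Unfolding `eqv` turns this into convertibility under `l`, after which both remaining
            -- derivations evaluate the same term.
            eqvE (eqvG (sub (su h) (sub (su g) m₁)) (sub (su h) (sub (su g) m₂)))
              (apply detEvalR (_ ∷ []) ih' (_ ∷ _ ∷ _ ∷ _ ∷ [])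
                ((a ↑ h) ∷ convSeq ≈refl ≈refl (≈⟨⟩ (≈sym ep) ≈refl) a' ∷ []))
              λ l er → apply detEvalR (_ ∷ []) (trF ⟦ detEvalR ⟧ (_ ∷ []) l ih') (_ ∷ _ ∷ _ ∷ _ ∷ [])
                ((b ↑ h ↑ l) ∷ convSeq ≈refl ≈refl
                                 (≈⟨⟩ (≈app (≈sym (con-inj₁ er)) (sub-≈ (su l) (≈sym en))) ≈refl) (b' ↑ l) ∷ []) } } }

detStepR : Rule (N ∷ [])
detStepR = rule (I ∷ I ∷ I ∷ N ∷ []) (Seq v4 NIL (v0 ↝ v1) ∷ Seq v3 NIL (v0 ↝ v2) ∷ []) (atom (con eqv · v1 · v2))

detStep : {k : Tm Σ N} → Σ ⨾ Π ⟶ Nat k → Σ ⨾ Π ⟶ ⟦ detStepR ⟧ ∣ (k ∷ [])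
detStep = natI₂ ⟦ detStepR ⟧ λ t ih → intros detStepR (t ∷ []) λ { f (m ∷ m₁ ∷ m₂ ∷ j ∷ []) (d₁ ∷ d₂ ∷ []) →
  stepE (eqvG m₁ m₂) d₁ λ
    { g (stBeta e₁ e₂) → stepE (eqvG (sub (su g) m₁) (sub (su g) m₂)) (d₂ ↑ g) λ
        { h (stBeta e₁' e₂') →
            let er , ep = con-inj₂ (≈trans (sub-≈ (su h) (≈sym e₁)) e₁') in
            eqvI (≈trans (sub-≈ (su h) e₂) (≈trans (≈app (con-inj₁ er) ep) (≈sym e₂')))
        -- The function part of a β-redex is an abstraction and does not step.
        ; h (stApp _ e' _ b) →
            abs-↝ (eqvG _ _) (≈sym (proj₁ (con-inj₂ (≈trans (sub-≈ (su h) (≈sym e₁)) e')))) b }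
    ; g (stApp ek e₁ e₂ a) → stepE (eqvG (sub (su g) m₁) (sub (su g) m₂)) (d₂ ↑ g) λ
        { h (stBeta e₁' _) →
            abs-↝ (eqvG _ _) (proj₁ (con-inj₂ (≈trans (sub-≈ (su h) (≈sym e₁)) e₁'))) (a ↑ h)
        ; h (stApp _ e₁' e₂' a') →
            let ih' = trF ⟦ detStepR ⟧ (_ ∷ []) h (ih (f ⨟ g) (one (≈trans (≈-⨟ f g t) ek)))
                ep , en = con-inj₂ (≈trans (sub-≈ (su h) (≈sym e₁)) e₁') in
            eqvE (eqvG (sub (su h) (sub (su g) m₁)) (sub (su h) (sub (su g) m₂)))
              (apply detStepR (_ ∷ []) ih' (_ ∷ _ ∷ _ ∷ _ ∷ [])
                ((a ↑ h) ∷ convSeq ≈refl ≈refl (≈⟨⟩ (≈sym ep) ≈refl) a' ∷ []))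
              λ l e → eqvI (≈trans (sub-≈ (su l) (sub-≈ (su h) e₂))
                             (≈trans (≈con₂ e (sub-≈ (su l) en)) (sub-≈ (su l) (≈sym e₂')))) } } }

-- Abstractions as targets refute the mixed cases, in which one reduction stops and the other goes
-- on. `Nat` is a premise because `natI₂` supplies none for the predecessor and `detStep` asks for
-- it.
detStepsR : Rule (N ∷ [])
detStepsR = rule (I ∷ (I ⇒ I) ∷ (I ⇒ I) ∷ N ∷ [])
  (Nat v4 ∷ Seq v4 NIL (v0 ↝* abs v1) ∷ Seq v3 NIL (v0 ↝* abs v2) ∷ []) (atom (con eqv · abs v1 · abs v2))

detSteps : {k : Tm Σ N} → Σ ⨾ Π ⟶ Nat k → Σ ⨾ Π ⟶ ⟦ detStepsR ⟧ ∣ (k ∷ [])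
detSteps = natI₂ ⟦ detStepsR ⟧ λ t ih → intros detStepsR (t ∷ []) λ { f (m ∷ r₁ ∷ r₂ ∷ j ∷ []) (n ∷ d₁ ∷ d₂ ∷ []) →
  stepsE (eqvG (abs r₁) (abs r₂)) d₁ λ
    { g (stsRefl e) → stepsE (eqvG (abs (sub (su g) r₁)) (abs (sub (su g) r₂))) (d₂ ↑ g) λ
        { h (stsRefl e') → eqvI (≈trans (sub-≈ (su h) (≈sym e)) e')
        ; h (stsStep _ a _) → abs-↝ (eqvG _ _) (sub-≈ (su h) e) a }
    ; g (stsStep ek a b) → stepsE (eqvG (abs (sub (su g) r₁)) (abs (sub (su g) r₂))) (d₂ ↑ g) λ
        { h (stsRefl e) → abs-↝ (eqvG _ _) e (a ↑ h)
        ; h (stsStep _ a' b') →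
            let ih' = trF ⟦ detStepsR ⟧ (_ ∷ []) h (ih (f ⨟ g) (two (≈trans (≈-⨟ f g t) ek)))
                n' = natPred ≈refl (natPred ek (n ↑ g)) ↑ h in
            eqvE (eqvG (abs (sub (su h) (sub (su g) r₁))) (abs (sub (su h) (sub (su g) r₂))))
              (apply detStepR (_ ∷ []) (detStep n') (_ ∷ _ ∷ _ ∷ _ ∷ []) ((a ↑ h) ∷ a' ∷ []))
              λ l e → apply detStepsR (_ ∷ []) (trF ⟦ detStepsR ⟧ (_ ∷ []) l ih') (_ ∷ _ ∷ _ ∷ _ ∷ [])
                ((n' ↑ l) ∷ (b ↑ h ↑ l) ∷ convSeq ≈refl ≈refl (≈⟨⟩ (≈sym e) ≈refl) (b' ↑ l) ∷ []) } } }

-- Equivalence of the two semantics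

-- The function part is reduced under `c-stApp`, then the redex is contracted. The remaining
-- reduction is a `⊢` premise, so that its index stays out of the induction.
stepsAppR : Rule (N ∷ [])
stepsAppR = rule (I ∷ (I ⇒ I) ∷ I ∷ I ∷ [])
  (Nat v4 ∷ Seq v4 NIL (v0 ↝* abs v1) ∷ (⊢ ((v1 · v2) ↝* v3)) ∷ []) (⊢ (app v0 v2 ↝* v3))

stepsApp : {k : Tm Σ N} → Σ ⨾ Π ⟶ Nat k → Σ ⨾ Π ⟶ ⟦ stepsAppR ⟧ ∣ (k ∷ [])
stepsApp = natI₂ ⟦ stepsAppR ⟧ λ t ih → intros stepsAppR (t ∷ []) λ { f (m ∷ r ∷ n ∷ v ∷ []) (nt' ∷ d ∷ e ∷ []) →
  stepsE (prv (app m n ↝* v)) d λ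
    { g (stsRefl q) → ⊢stsStep (⊢conv (≈⟨⟩ (≈con₂ (≈sym q) ≈refl) ≈refl) ⊢stBeta) (⊢tr {b = (r · n) ↝* v} g e)
    ; g (stsStep ek a b) →
        let n' = natPred ≈refl (natPred ek (nt' ↑ g)) in
        ⊢stsStep (⊢stApp (⊢I n' a))
          (apply stepsAppR (_ ∷ []) (ih (f ⨟ g) (two (≈trans (≈-⨟ f g t) ek))) (_ ∷ sub (su g) r ∷ sub (su g) n ∷ sub (su g) v ∷ [])
            (n' ∷ b ∷ ⊢tr {b = (r · n) ↝* v} g e ∷ [])) } }

evalStepsR : Rule (N ∷ [])
evalStepsR = rule (I ∷ I ∷ []) (Nat v2 ∷ Seq v2 NIL (v0 ⇓ v1) ∷ []) (⊢ (v0 ↝* v1))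

evalSteps : {k : Tm Σ N} → Σ ⨾ Π ⟶ Nat k → Σ ⨾ Π ⟶ ⟦ evalStepsR ⟧ ∣ (k ∷ [])
evalSteps = natI₂ ⟦ evalStepsR ⟧ λ t ih → intros evalStepsR (t ∷ []) λ { f (m ∷ v ∷ []) (n ∷ d ∷ []) →
  evalE (prv (m ↝* v)) d λ
    { g (evAbs e₁ e₂) → ⊢conv (≈⟨⟩ (≈sym e₁) (≈sym e₂)) ⊢stsRefl
    ; g (evApp {n = p} {r = r} ek e a b) →
        let n' = natPred ≈refl (natPred ek (n ↑ g))
            ih' = ih (f ⨟ g) (two (≈trans (≈-⨟ f g t) ek))
            ⊢b = apply evalStepsR (_ ∷ []) ih' (r · p ∷ sub (su g) v ∷ []) (n' ∷ b ∷ []) in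
        -- The reduction obtained from the induction hypothesis has a new index unrelated to the
        -- current one; hence the appeal to `stepsApp`, which has its own induction.
        ⊢E (prv (sub (su g) m ↝* sub (su g) v)) _
          (apply evalStepsR (_ ∷ []) ih' (_ ∷ abs r ∷ []) (n' ∷ a ∷ [])) λ h k' nk d' →
          ⊢conv (≈⟨⟩ (≈sym (sub-≈ (su h) e)) ≈refl)
            (apply stepsAppR (_ ∷ []) (stepsApp nk) (_ ∷ sub (su h) r ∷ sub (su h) p ∷ sub (su h) (sub (su g) v) ∷ [])
              (nk ∷ d' ∷ ⊢tr {b = (r · p) ↝* sub (su g) v} h ⊢b ∷ [])) } }

-- Evaluation is closed under expansion, by induction on the step. Under `c-stApp` the reduct is an
-- application, so its evaluation supplies one of the reduced function part, to which the hypothesis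
-- applies.
evalExpandR : Rule (N ∷ [])
evalExpandR = rule (I ∷ I ∷ I ∷ []) (Seq v3 NIL (v0 ↝ v1) ∷ (⊢ (v1 ⇓ v2)) ∷ []) (⊢ (v0 ⇓ v2))

evalExpand : {k : Tm Σ N} → Σ ⨾ Π ⟶ Nat k → Σ ⨾ Π ⟶ ⟦ evalExpandR ⟧ ∣ (k ∷ [])
evalExpand = natI₂ ⟦ evalExpandR ⟧ λ t ih → intros evalExpandR (t ∷ []) λ { f (m ∷ m' ∷ v ∷ []) (d ∷ e ∷ []) →
  stepE (prv (m ⇓ v)) d λ
    { g (stBeta e₁ e₂) → ⊢conv (≈⟨⟩ (≈sym e₁) ≈refl)
        (⊢evApp ⊢evAbs (⊢conv (≈⟨⟩ e₂ ≈refl) (⊢tr {b = m' ⇓ v} g e)))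
    ; g (stApp ek e₁ e₂ a) →
        ⊢E (prv (sub (su g) (m ⇓ v))) _ (⊢tr {b = m' ⇓ v} g e) λ h k' nk d' →
        evalE (prv (sub (su h) (sub (su g) (m ⇓ v)))) d' λ
          { l (evAbs q _) → clash (≈trans (sub-≈ (su l) (sub-≈ (su h) (≈sym e₂))) q) λ ()
          ; l (evApp {r = r} ek' q b₁ b₂) →
              let ih' = trF ⟦ evalExpandR ⟧ (_ ∷ []) l
                          (trF ⟦ evalExpandR ⟧ (_ ∷ []) h (ih (f ⨟ g) (one (≈trans (≈-⨟ f g t) ek))))
                  n' = natPred ≈refl (natPred ek' (nk ↑ l))
                  ep , en = con-inj₂ (≈trans (sub-≈ (su l) (sub-≈ (su h) (≈sym e₂))) q) in
              ⊢conv (≈⟨⟩ (sub-≈ (su l) (sub-≈ (su h) (≈sym e₁))) ≈refl)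
                (⊢evApp
                  (apply evalExpandR (_ ∷ []) ih' (_ ∷ _ ∷ abs r ∷ [])
                    ((a ↑ h ↑ l) ∷ ⊢conv (≈⟨⟩ (≈sym ep) ≈refl) (⊢I n' b₁) ∷ []))
                  (⊢conv (≈⟨⟩ (≈app ≈refl (≈sym en)) ≈refl) (⊢I n' b₂))) } } }

-- Starting from the evaluation of `abs r` to itself, `evalExpand` is applied backwards along the
-- reduction; an abstraction as target is what provides the start.
stepsEvalR : Rule (N ∷ [])
stepsEvalR = rule (I ∷ (I ⇒ I) ∷ []) (Nat v2 ∷ Seq v2 NIL (v0 ↝* abs v1) ∷ []) (⊢ (v0 ⇓ abs v1))

stepsEval : {k : Tm Σ N} → Σ ⨾ Π ⟶ Nat k → Σ ⨾ Π ⟶ ⟦ stepsEvalR ⟧ ∣ (k ∷ [])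
stepsEval = natI₂ ⟦ stepsEvalR ⟧ λ t ih → intros stepsEvalR (t ∷ []) λ { f (m ∷ r ∷ []) (n ∷ d ∷ []) →
  stepsE (prv (m ⇓ abs r)) d λ
    { g (stsRefl e) → ⊢conv (≈⟨⟩ (≈sym e) ≈refl) ⊢evAbs
    ; g (stsStep ek a b) →
        let n' = natPred ≈refl (natPred ek (n ↑ g)) in
        apply evalExpandR (_ ∷ []) (evalExpand n') (_ ∷ _ ∷ sub (su g) (abs r) ∷ [])
          (a ∷ apply stepsEvalR (_ ∷ []) (ih (f ⨟ g) (two (≈trans (≈-⨟ f g t) ek))) (_ ∷ sub (su g) r ∷ []) (n' ∷ b ∷ []) ∷ []) } }

-- Subject reduction

-- The type is quantified inside the induction formula, since the function part is needed at an
-- arrow type.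
srStepR : Rule (N ∷ [])
srStepR = rule (I ∷ I ∷ I ∷ []) (Seq v3 NIL (v0 ↝ v1) ∷ (⊢ (v0 ∶ v2)) ∷ []) (⊢ (v1 ∶ v2))

srStep : {k : Tm Σ N} → Σ ⨾ Π ⟶ Nat k → Σ ⨾ Π ⟶ ⟦ srStepR ⟧ ∣ (k ∷ [])
srStep = natI₂ ⟦ srStepR ⟧ λ t ih → intros srStepR (t ∷ []) λ { f (m ∷ n ∷ ty ∷ []) (d ∷ e ∷ []) →
  stepE (prv (n ∶ ty)) d λ
    { g (stBeta e₁ e₂) →
        ∶appE (prv (sub (su g) (n ∶ ty))) (⊢conv (≈⟨⟩ e₁ ≈refl) (⊢tr {b = m ∶ ty} g e)) λ h a b →
          ⊢conv (≈⟨⟩ (sub-≈ (su h) (≈sym e₂)) ≈refl) (∶β a b)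
    ; g (stApp ek e₁ e₂ d') →
        ∶appE (prv (sub (su g) (n ∶ ty))) (⊢conv (≈⟨⟩ e₁ ≈refl) (⊢tr {b = m ∶ ty} g e)) λ h {u} a b →
          ⊢conv (≈⟨⟩ (sub-≈ (su h) (≈sym e₂)) ≈refl)
            (⊢tyApp (apply srStepR (_ ∷ []) (trF ⟦ srStepR ⟧ (_ ∷ []) h (ih (f ⨟ g) (one (≈trans (≈-⨟ f g t) ek))))
                       (_ ∷ _ ∷ con arr · u · sub (su h) (sub (su g) ty) ∷ []) ((d' ↑ h) ∷ a ∷ [])) b) } }

srEvalR : Rule (N ∷ [])
srEvalR = rule (I ∷ I ∷ I ∷ []) (Seq v3 NIL (v0 ⇓ v1) ∷ (⊢ (v0 ∶ v2)) ∷ []) (⊢ (v1 ∶ v2))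

srEval : {k : Tm Σ N} → Σ ⨾ Π ⟶ Nat k → Σ ⨾ Π ⟶ ⟦ srEvalR ⟧ ∣ (k ∷ [])
srEval = natI₂ ⟦ srEvalR ⟧ λ t ih → intros srEvalR (t ∷ []) λ { f (m ∷ n ∷ ty ∷ []) (d ∷ e ∷ []) →
  evalE (prv (n ∶ ty)) d λ
    { g (evAbs e₁ e₂) → ⊢conv (≈⟨⟩ (≈trans e₁ (≈sym e₂)) ≈refl) (⊢tr {b = m ∶ ty} g e)
    ; g (evApp ek e₁ a b) →
        ∶appE (prv (sub (su g) (n ∶ ty))) (⊢conv (≈⟨⟩ e₁ ≈refl) (⊢tr {b = m ∶ ty} g e)) λ h {u} a' b' →
          let ih' = trF ⟦ srEvalR ⟧ (_ ∷ []) h (ih (f ⨟ g) (two (≈trans (≈-⨟ f g t) ek)))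
              ty' = sub (su h) (sub (su g) ty) in
          -- The inner use of the hypothesis types the abstraction, `∶β` types the contracted redex,
          -- and the outer use types its value.
          apply srEvalR (_ ∷ []) ih' (_ ∷ _ ∷ ty' ∷ [])
            ((b ↑ h) ∷ ∶β (apply srEvalR (_ ∷ []) ih' (_ ∷ _ ∷ con arr · u · ty' ∷ []) ((a ↑ h) ∷ a' ∷ [])) b' ∷ []) } }

srStepsR : Rule (N ∷ [])
srStepsR = rule (I ∷ I ∷ I ∷ []) (Nat v3 ∷ Seq v3 NIL (v0 ↝* v1) ∷ (⊢ (v0 ∶ v2)) ∷ []) (⊢ (v1 ∶ v2))

srSteps : {k : Tm Σ N} → Σ ⨾ Π ⟶ Nat k → Σ ⨾ Π ⟶ ⟦ srStepsR ⟧ ∣ (k ∷ [])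
srSteps = natI₂ ⟦ srStepsR ⟧ λ t ih → intros srStepsR (t ∷ []) λ { f (m ∷ n ∷ ty ∷ []) (nt' ∷ d ∷ e ∷ []) →
  stepsE (prv (n ∶ ty)) d λ
    { g (stsRefl q) → ⊢conv (≈⟨⟩ q ≈refl) (⊢tr {b = m ∶ ty} g e)
    ; g (stsStep ek a b) →
        let n' = natPred ≈refl (natPred ek (nt' ↑ g)) in
        apply srStepsR (_ ∷ []) (ih (f ⨟ g) (two (≈trans (≈-⨟ f g t) ek))) (_ ∷ _ ∷ sub (su g) ty ∷ [])
          (n' ∷ b ∷ apply srStepR (_ ∷ []) (srStep n') (_ ∷ _ ∷ sub (su g) ty ∷ []) (a ∷ ⊢tr {b = m ∶ ty} g e ∷ []) ∷ []) } }

-- From indexed statements to the closed formulas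

-- The rule given to `intros` computes to the required formula. What remains is to open each `⊢`,
-- transporting the other derivation past the new index.
determinacyI : (R : ATMREL) →
  (∀ {Σ} {Π : List (Form Σ)} {k j : Tm Σ N} {m m₁ m₂} → Σ ⨾ Π ⟶ Nat k →
   Σ ⨾ Π ⟶ Seq k NIL ⟨ con R · m · m₁ ⟩ → Σ ⨾ Π ⟶ Seq j NIL ⟨ con R · m · m₂ ⟩ → Σ ⨾ Π ⟶ atom (con eqv · m₁ · m₂)) →
  Derivable (determinacy R)
determinacyI R h = intros (rule (I ∷ I ∷ I ∷ []) ((⊢ ⟨ con R · v2 · v1 ⟩) ∷ (⊢ ⟨ con R · v2 · v0 ⟩) ∷ []) (atom (con eqv · v1 · v0))) []
  λ { f (m₂ ∷ m₁ ∷ m ∷ []) (d₁ ∷ d₂ ∷ []) →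
    ⊢E (eqvG m₁ m₂) ⟨ con R · m · m₁ ⟩ d₁ λ g k n d₁' →
    ⊢E (eqvG (sub (su g) m₁) (sub (su g) m₂)) _ (⊢tr {b = ⟨ con R · m · m₂ ⟩} g d₂) λ g' k' _ d₂' →
      h (n ↑ g') (d₁' ↑ g') d₂' }

equivalenceI : (R R' : ATMREL) →
  (∀ {Σ} {Π : List (Form Σ)} {k : Tm Σ N} {m r} → Σ ⨾ Π ⟶ Nat k →
   Σ ⨾ Π ⟶ Seq k NIL ⟨ con R · m · abs r ⟩ → Σ ⨾ Π ⟶ ⊢ ⟨ con R' · m · abs r ⟩) →
  Derivable (equivalence R R')
equivalenceI R R' h =
  intros (rule ((I ⇒ I) ∷ I ∷ []) ((⊢ ⟨ con R · v1 · abs v0 ⟩) ∷ []) (⊢ ⟨ con R' · v1 · abs v0 ⟩)) []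
    λ { f (r ∷ m ∷ []) (d ∷ []) → ⊢E (prv ⟨ con R' · m · abs r ⟩) ⟨ con R · m · abs r ⟩ d λ g k n d' → h n d' }

subjectReductionI : (R : ATMREL) →
  (∀ {Σ} {Π : List (Form Σ)} {k : Tm Σ N} {m n t} → Σ ⨾ Π ⟶ Nat k →
   Σ ⨾ Π ⟶ Seq k NIL ⟨ con R · m · n ⟩ → Σ ⨾ Π ⟶ ⊢ (m ∶ t) → Σ ⨾ Π ⟶ ⊢ (n ∶ t)) →
  Derivable (subjectReduction R)
subjectReductionI R h =
  intros (rule (I ∷ I ∷ []) ((⊢ ⟨ con R · v1 · v0 ⟩) ∷ []) ⟦ typing ⟧) [] λ { f (n ∷ m ∷ []) (d ∷ []) →
    intros typing (n ∷ m ∷ []) λ { f' (t ∷ []) (e ∷ []) →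
      ⊢E (prv (sub (su f') n ∶ t)) _ (⊢tr {b = ⟨ con R · m · n ⟩} f' d) λ g k nk d' →
        h nk d' (⊢tr {b = sub (su f') m ∶ t} g e) } }
  where
  typing : Rule (I ∷ I ∷ [])
  typing = rule (I ∷ []) ((⊢ (v2 ∶ v0)) ∷ []) (⊢ (v1 ∶ v0))

determinacyStarI : Derivable determinacyStar
determinacyStarI =
  intros (rule ((I ⇒ I) ∷ (I ⇒ I) ∷ I ∷ []) ((⊢ (v2 ↝* abs v1)) ∷ (⊢ (v2 ↝* abs v0)) ∷ []) (atom (con eqv · abs v1 · abs v0))) []
    λ { f (r₂ ∷ r₁ ∷ m ∷ []) (d₁ ∷ d₂ ∷ []) →
      ⊢E (eqvG (abs r₁) (abs r₂)) (m ↝* abs r₁) d₁ λ g k n d₁' →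
      ⊢E (eqvG (sub (su g) (abs r₁)) (sub (su g) (abs r₂))) _ (⊢tr {b = m ↝* abs r₂} g d₂) λ g' k' _ d₂' →
        apply detStepsR (_ ∷ []) (detSteps (n ↑ g')) (_ ∷ _ ∷ _ ∷ _ ∷ []) ((n ↑ g') ∷ (d₁' ↑ g') ∷ d₂' ∷ []) }

theorem8p1 : Derivable (determinacy evalC)
    × Derivable (determinacy stepC)
    × Derivable determinacyStar
    × Derivable (equivalence evalC stepsC)
    × Derivable (equivalence stepsC evalC)
    × Derivable (subjectReduction evalC)
    × Derivable (subjectReduction stepC)
    × Derivable (subjectReduction stepsC)
theorem8p1 =
    determinacyI evalC (λ n d e → apply detEvalR (_ ∷ []) (detEval n) (_ ∷ _ ∷ _ ∷ _ ∷ []) (d ∷ e ∷ []))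
  , determinacyI stepC (λ n d e → apply detStepR (_ ∷ []) (detStep n) (_ ∷ _ ∷ _ ∷ _ ∷ []) (d ∷ e ∷ []))
  , determinacyStarI
  , equivalenceI evalC stepsC (λ {_ _ _ m r} n d → apply evalStepsR (_ ∷ []) (evalSteps n) (m ∷ abs r ∷ []) (n ∷ d ∷ []))
  , equivalenceI stepsC evalC (λ {_ _ _ m r} n d → apply stepsEvalR (_ ∷ []) (stepsEval n) (m ∷ r ∷ []) (n ∷ d ∷ []))
  , subjectReductionI evalC (λ {_ _ _ _ _ t} n d e → apply srEvalR (_ ∷ []) (srEval n) (_ ∷ _ ∷ t ∷ []) (d ∷ e ∷ []))
  , subjectReductionI stepC (λ {_ _ _ _ _ t} n d e → apply srStepR (_ ∷ []) (srStep n) (_ ∷ _ ∷ t ∷ []) (d ∷ e ∷ []))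
  , subjectReductionI stepsC (λ {_ _ _ _ _ t} n d e → apply srStepsR (_ ∷ []) (srSteps n) (_ ∷ _ ∷ t ∷ []) (n ∷ d ∷ e ∷ []))
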